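{- Let $d \geq 2$ and $k \in \{1, \ldots, d-1\}$ be integers. Then $$\underline{sa}_d^s(d+k) \geq \frac{d^2 - k^2 + d + k}{2} = \Theta((d-k)d).$$
   Context: Let $X=\{x_1,\dots,x_n\}\subset\mathbb{R}^d$ be a finite set (with $x_i\neq x_j$ for $i\ne j$) whose affine hull is $\mathbb{R}^d$, and let $P=\operatorname{conv}X$. Two distinct points $x_i,x_j\in X$ are strictly antipodal (in $X$) if there are different parallel supporting hyperplanes $H',H''$ of $P$ with $X\cap H'=\{x_i\}$ and $X\cap H''=\{x_j\}$. $sa(X)$ is the number of (unordered) strictly antipodal pairs of $X$. $X$ is in strictly convex position if $X=\operatorname{vert}P$ (the vertex set of $P$). $\mathcal{C}_d^s(n)$ is the family of all $X\subset\mathbb{R}^d$ with $|X|=n$, $\operatorname{aff}X=\mathbb{R}^d$, $X$ in strictly convex position, and $\underline{sa}_d^s(n):=\min\{sa(X)\mid X\in\mathcal{C}_d^s(n)\}$. The $\Theta(\cdot)$ relation means that the explicit expression lies between positive absolute constant multiples of $(d-k)d$, over the stated range of $d,k$. -}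

module Defs where

open import Level using (0ℓ)
open import Algebra.Bundles using (CommutativeRing)
open import Axiom.ExcludedMiddle using (ExcludedMiddle)
open import Data.Nat as ℕ using (ℕ)
open import Data.Integer as ℤ using (+_)
open import Data.Rational as ℚ using (ℚ; 0ℚ)
open import Data.Fin using (Fin; _<_)
open import Data.List using (length; filter; cartesianProduct; allFin)
open import Data.Product using (Σ-syntax; ∃; ∃-syntax; _×_; _,_)
open import Data.Sum using (_⊎_)
open import Data.Vec.Functional using (Vector)
open import Function.Definitions using (Injective)
open import Relation.Binary using (Rel; IsTotalOrder)
open import Relation.Binary.PropositionalEquality using (_≡_)
open import Relation.Nullary using (¬_)
open import Relation.Unary using (Pred; Satisfiable; _∈_; _∩_; _≐_)

-- The real numbers, axiomatised as a Dedekind-complete totally ordered field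
-- (up to isomorphism there is only one).  Equality is a setoid equality, so
-- that for instance Cauchy sequences of rationals can serve as the carrier.
record Reals : Set₁ where
  infix 4 _≤_
  field
    commutativeRing : CommutativeRing 0ℓ 0ℓ
  open CommutativeRing commutativeRing public
  field
    0≉1          : ¬ (0# ≈ 1#)
    inverse      : ∀ x → ¬ (x ≈ 0#) → ∃[ y ] x * y ≈ 1#
    _≤_          : Rel Carrier 0ℓ
    isTotalOrder : IsTotalOrder _≈_ _≤_
    +-monoˡ-≤    : ∀ z {x y} → x ≤ y → x + z ≤ y + z
    *-nonNeg     : ∀ {x y} → 0# ≤ x → 0# ≤ y → 0# ≤ x * y

  UpperBound : Pred Carrier 0ℓ → Pred Carrier 0ℓ
  UpperBound S b = ∀ {x} → x ∈ S → x ≤ b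

  field
    supremum : (S : Pred Carrier 0ℓ) → Satisfiable S → Satisfiable (UpperBound S) →
               ∃[ s ] UpperBound S s × (∀ {b} → UpperBound S b → s ≤ b)

IsMinimum : Pred ℕ 0ℓ → Pred ℕ 0ℓ
IsMinimum S m = m ∈ S × (∀ {s} → s ∈ S → m ℕ.≤ s)

module Geometry (ℝ : Reals) where
  open Reals ℝ
  open import Algebra.Definitions.RawMonoid +-rawMonoid using (sum)

  infix 4 _≋_

  Point : ℕ → Set
  Point d = Vector Carrier d

  _≋_ : ∀ {d} → Rel (Point d) 0ℓ
  p ≋ q = ∀ a → p a ≈ q a

  singleton : ∀ {d} → Point d → Pred (Point d) 0ℓ
  singleton p q = q ≋ p

  dot : ∀ {d} → Point d → Point d → Carrier
  dot u p = sum (λ a → u a * p a)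

  -- A family x of n points stands for the set X = {x₁, …, xₙ}.
  ⟦_⟧ : ∀ {n d} → Vector (Point d) n → Pred (Point d) 0ℓ
  ⟦ x ⟧ p = ∃[ i ] p ≋ x i

  combination : ∀ {n d} → Vector Carrier n → Vector (Point d) n → Point d
  combination w x a = sum (λ i → w i * x i a)

  aff : ∀ {n d} → Vector (Point d) n → Pred (Point d) 0ℓ
  aff x p = ∃[ w ] sum w ≈ 1# × p ≋ combination w x

  conv : ∀ {n d} → Vector (Point d) n → Pred (Point d) 0ℓ
  conv x p = ∃[ w ] (∀ i → 0# ≤ w i) × sum w ≈ 1# × p ≋ combination w x

  record Hyperplane (d : ℕ) : Set where
    field
      normal  : Point d
      offset  : Carrier
      nonzero : ¬ (∀ a → normal a ≈ 0#)

    points : Pred (Point d) 0ℓ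
    points p = dot normal p ≈ offset

  open Hyperplane

  Parallel : ∀ {d} → Rel (Hyperplane d) 0ℓ
  Parallel H H′ = ∃[ t ] (∀ a → normal H′ a ≈ t * normal H a)

  -- The same hyperplane has many (normal, offset) pairs, so being different
  -- is a condition on the point sets.
  Different : ∀ {d} → Rel (Hyperplane d) 0ℓ
  Different H H′ = ¬ (points H ≐ points H′)

  Supports : ∀ {d} → Hyperplane d → Pred (Point d) 0ℓ → Set
  Supports H P =
    Satisfiable (P ∩ points H) ×
    ((∀ {p} → p ∈ P → dot (normal H) p ≤ offset H) ⊎
     (∀ {p} → p ∈ P → offset H ≤ dot (normal H) p))

  -- Vertices are the zero-dimensional faces, a proper face being the
  -- intersection with a supporting hyperplane.
  vert : ∀ {d} → Pred (Point d) 0ℓ → Pred (Point d) 0ℓ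
  vert P v = Σ[ H ∈ Hyperplane _ ] Supports H P × (P ∩ points H) ≐ singleton v

  StrictlyAntipodal : ∀ {n d} → Vector (Point d) n → Rel (Fin n) 0ℓ
  StrictlyAntipodal x i j =
    ¬ (x i ≋ x j) ×
    Σ[ H′ ∈ Hyperplane _ ] Σ[ H″ ∈ Hyperplane _ ]
      Different H′ H″ × Parallel H′ H″ ×
      Supports H′ (conv x) × Supports H″ (conv x) ×
      (⟦ x ⟧ ∩ points H′) ≐ singleton (x i) ×
      (⟦ x ⟧ ∩ points H″) ≐ singleton (x j)

  record 𝒞ˢ (d n : ℕ) (x : Vector (Point d) n) : Set where
    field
      distinct               : Injective _≡_ _≋_ x
      affinelySpanning       : ∀ p → p ∈ aff x
      strictlyConvexPosition : ⟦ x ⟧ ≐ vert (conv x)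

  module Counting (em : ExcludedMiddle 0ℓ) where

    -- Unordered pairs are listed as index pairs i < j; excluded middle
    -- decides which of them to count.
    sa : ∀ {n d} → Vector (Point d) n → ℕ
    sa {n} x = length (filter (λ (i , j) → em {i < j × StrictlyAntipodal x i j})
                              (cartesianProduct (allFin n) (allFin n)))

    -- m is min { sa X ∣ X ∈ 𝒞ˢ d n }
    IsMinSa : (d n m : ℕ) → Set
    IsMinSa d n = IsMinimum (λ s → ∃[ x ] 𝒞ˢ d n x × s ≡ sa x)

Range : ℕ → ℕ → Set
Range d k = 2 ℕ.≤ d × 1 ℕ.≤ k × k ℕ.< d

bound : ℕ → ℕ → ℚ
bound d k = (+ d ℤ.* + d ℤ.- + k ℤ.* + k ℤ.+ + d ℤ.+ + k) ℚ./ 2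

order : ℕ → ℕ → ℚ
order d k = ((+ d ℤ.- + k) ℤ.* + d) ℚ./ 1

-- f = Θ(g) over a range of parameters, with absolute constants.
Θ-on : (ℕ → ℕ → Set) → (f g : ℕ → ℕ → ℚ) → Set
Θ-on R f g =
  ∃[ c ] ∃[ C ] 0ℚ ℚ.< c × 0ℚ ℚ.< C ×
    (∀ d k → R d k → c ℚ.* g d k ℚ.≤ f d k × f d k ℚ.≤ C ℚ.* g d k)

{-# OPTIONS --safe #-}

-- Let U be the space of affine functionals on X, and induct on D = dim U = d + 1
-- to show that there are at least n (2 d + 1 - n) ordered antipodal pairs.
-- Choose a facet with point set F and let G be the set of points on the
-- opposite supporting hyperplane.  Project along the affine hull of G and one
-- point of F, so that G is merged with that point and D drops by at most |G|,
-- and pass to the vertices of the image.  Antipodal pairs of the image lift,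
-- by perturbing the functional, to antipodal pairs of X that avoid G.  If F′
-- denotes the vertices of the projection of F along the affine hull of G, then
-- each of them gives an antipodal pair with every point of G: these are
-- 2 |F′| |G| further ordered pairs.  As at most n - |G| - (|F| - |F′|) vertices
-- survive, |F| ≥ D - 1 and |F′| ≥ D - |G|, the bound is preserved.  The value
-- d² - k² + d + k is n (2 d + 1 - n) for n = d + k.
module Submission where

open import Defs
open import Level using (0ℓ)
open import Algebra.Bundles using (CommutativeRing)
open import Algebra.Solver.Ring.AlmostCommutativeRing using (fromCommutativeRing; _-Raw-AlmostCommutative⟶_)
import Algebra.Solver.Ring
open import Axiom.ExcludedMiddle using (ExcludedMiddle)
open import Data.Fin as Fin using (Fin; zero; suc; _≟_; punchIn; punchOut; splitAt; join; inject≤)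
import Data.Fin.Properties as FinP
open import Data.Integer as ℤ using (ℤ; +_; -[1+_]; +≤+; 1ℤ)
import Data.Integer.Properties as ℤP
import Data.Integer.Tactic.RingSolver as ℤSolver
open import Data.List as List using (List; []; _∷_; _++_; length; map; filter; cartesianProduct; allFin)
import Data.List.Extrema
import Data.List.Properties as ListP
open import Data.List.Membership.Propositional using (lose) renaming (_∈_ to _∈ˡ_)
open import Data.List.Membership.Propositional.Properties
  using (∈-∃++; ∈-++⁺ˡ; ∈-++⁺ʳ; ∈-++⁻; ∈-filter⁺; ∈-filter⁻; ∈-map⁺; ∈-cartesianProduct⁺; ∈-cartesianProduct⁻; ∈-length; ∈-allFin)
open import Data.List.Relation.Binary.Subset.Propositional using () renaming (_⊆_ to _⊆ˡ_)
open import Data.List.Relation.Unary.All as All using (All; []; _∷_)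
import Data.List.Relation.Unary.All.Properties as AllP
open import Data.List.Relation.Unary.Any as Any using (here; there)
import Data.List.Relation.Unary.Any.Properties as AnyP
open import Data.List.Relation.Unary.Unique.Propositional using (Unique; []; _∷_)
import Data.List.Relation.Unary.Unique.Propositional.Properties as UniqueP
open import Data.Maybe using (Maybe; just; nothing)
open import Data.Nat as ℕ using (ℕ; zero; suc)
open import Data.Nat.Induction using (<-wellFounded)
import Data.Nat.Properties as ℕP
import Data.Nat.Tactic.RingSolver as ℕSolver
open import Data.Product using (∃; ∃-syntax; _×_; _,_; proj₁; proj₂; swap)
open import Data.Rational as ℚ using (ℚ)
import Data.Rational.Properties as ℚP
open import Data.Rational.Unnormalised as ℚᵘ using (mkℚᵘ; *≤*)
import Data.Rational.Unnormalised.Properties as ℚᵘP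
open import Data.Sum using (_⊎_; inj₁; inj₂; map₁)
open import Data.Vec.Functional using (Vector)
open import Function using (case_of_)
open import Induction.WellFounded using (Acc; acc)
open import Relation.Binary using (TotalOrder; IsTotalOrder; tri<; tri≈; tri>)
open import Relation.Binary.PropositionalEquality as ≡ using (_≡_; _≢_)
open import Relation.Nullary using (¬_; yes; no; contradiction)
open import Relation.Nullary.Decidable using (¬?; decidable-stable)
open import Relation.Unary using (Pred; _∈_; _⊆_; _∩_)

-- No point ever moves: a configuration is a list of indices with a space of functionals, and
-- projecting means keeping only the functionals that are constant on the set to be collapsed.
-- Indices on which all remaining functionals agree stand for one point of the image. A supporting
-- functional of the image may therefore touch `S` in several points, and strictness has to be
-- regained by a perturbation with functionals that expose single points. Merging `G` with a point
-- of `F` is what prevents double counting: the merged point then has a representative outside `G`,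
-- so lifted pairs can be chosen outside `G` and differ from all pairs between `F` and `G`. A facet
-- is chosen, rather than any face, because the arithmetic needs |F| ≥ D - 1. The minimum must also
-- be shown to exist, which takes a member of the family: the vertices of a cross-polytope with d -
-- k of them removed.

-- Counting with duplicate-free lists

module Lists where
  open import Data.Nat using (suc; _+_; _*_; _≤_; z≤n; s≤s)

  Unique-⊆⇒length≤ : ∀ {a} {A : Set a} {xs ys : List A} → Unique xs → xs ⊆ˡ ys → length xs ≤ length ys
  Unique-⊆⇒length≤ [] _ = z≤n
  Unique-⊆⇒length≤ {xs = x ∷ xs} (x∉xs ∷ uniq) xs⊆ys
    with as , bs , ≡.refl ← ∈-∃++ (xs⊆ys (here ≡.refl)) = begin
    suc (length xs)                ≤⟨ s≤s (Unique-⊆⇒length≤ uniq xs⊆) ⟩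
    suc (length (as ++ bs))        ≡⟨ ListP.length-++-sucʳ as x bs ⟨
    length (as ++ x ∷ bs)          ∎
    where
    open ℕP.≤-Reasoning
    xs⊆ : xs ⊆ˡ as ++ bs
    xs⊆ y∈xs with ∈-++⁻ as (xs⊆ys (there y∈xs))
    ... | inj₁ y∈as            = ∈-++⁺ˡ y∈as
    ... | inj₂ (here ≡.refl)   = contradiction ≡.refl (All.lookup x∉xs y∈xs)
    ... | inj₂ (there y∈bs)    = ∈-++⁺ʳ as y∈bs

  -- `P` is a relation because the preimage is recognised by a property of the image, such as
  -- agreement of functionals. An image chosen twice would have two preimages under `P`, so the new
  -- list has no repetitions.
  transport : ∀ {a b p} {A : Set a} {B : Set b} (P : A → B → Set p) {xs} →
    (∀ {x} → x ∈ˡ xs → ∃ (P x)) →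
    (∀ {x x′ y} → x ∈ˡ xs → x′ ∈ˡ xs → P x y → P x′ y → x ≡ x′) →
    Unique xs →
    ∃[ ys ] Unique ys × length ys ≡ length xs × All (λ y → ∃[ x ] x ∈ˡ xs × P x y) ys
  transport P image injective [] = [] , [] , ≡.refl , []
  transport P {xs = x ∷ xs} image injective (x∉xs ∷ uniq)
    with ys , uniqʸ , len , all ←
           transport P (λ z → image (there z)) (λ z z′ → injective (there z) (there z′)) uniq
    with y , Pxy ← image (here ≡.refl)
    = y ∷ ys
    , All.map (λ { (x′ , x′∈ , Px′y′) ≡.refl →
                   All.lookup x∉xs x′∈ (injective (here ≡.refl) (there x′∈) Pxy Px′y′) }) all ∷ uniqʸ
    , ≡.cong suc len
    , (x , here ≡.refl , Pxy) ∷ All.map (λ (x′ , x′∈ , P′) → x′ , there x′∈ , P′) all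

  length-cartesianProduct : ∀ {a b} {A : Set a} {B : Set b} (xs : List A) (ys : List B) →
    length (cartesianProduct xs ys) ≡ length xs * length ys
  length-cartesianProduct []       ys = ≡.refl
  length-cartesianProduct (x ∷ xs) ys = ≡.trans (ListP.length-++ (map (x ,_) ys))
    (≡.cong₂ _+_ (ListP.length-map (x ,_) ys) (length-cartesianProduct xs ys))

-- The inequality behind the induction

module Arithmetic where
  open import Data.Nat using (zero; suc; _+_; _*_; _∸_; _≤_; s≤s)
  open import Data.Nat.Tactic.RingSolver using (solve-∀)
  open ℕP.≤-Reasoning

  -- With g = y + h the claim is h(h - 1) ≤ (z + y)(z + y + 1), and the hypothesis says h ≤ z + 1.
  -- The case h = 0 is split off so that h - 1 is a natural number `j` and z = j + t.
  square-bound : ∀ g y z → g ≤ 1 + (z + y) → g * g ≤ 2 * (g * y) + (z * z + 2 * (z * y) + z) + g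
  square-bound g y z g≤ with ℕP.≤-total g y
  ... | inj₁ g≤y = begin
    g * g                                              ≤⟨ ℕP.*-monoʳ-≤ g g≤y ⟩
    g * y                                              ≤⟨ ℕP.m≤m+n _ _ ⟩
    2 * (g * y)                                        ≤⟨ ℕP.m≤m+n _ _ ⟩
    2 * (g * y) + (z * z + 2 * (z * y) + z)            ≤⟨ ℕP.m≤m+n _ _ ⟩
    2 * (g * y) + (z * z + 2 * (z * y) + z) + g        ∎
  ... | inj₂ y≤g with h , ≡.refl ← ℕP.m≤n⇒∃[o]m+o≡n y≤g with h
  ... | zero  = begin
    (y + 0) * (y + 0)                                  ≤⟨ ℕP.≤-reflexive (≡.cong ((y + 0) *_) (ℕP.+-identityʳ y)) ⟩
    (y + 0) * y                                        ≤⟨ ℕP.m≤m+n _ _ ⟩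
    2 * ((y + 0) * y)                                  ≤⟨ ℕP.m≤m+n _ _ ⟩
    2 * ((y + 0) * y) + (z * z + 2 * (z * y) + z)      ≤⟨ ℕP.m≤m+n _ _ ⟩
    2 * ((y + 0) * y) + (z * z + 2 * (z * y) + z) + (y + 0) ∎
  ... | suc j with t , ≡.refl ← ℕP.m≤n⇒∃[o]m+o≡n (ℕP.+-cancelˡ-≤ (1 + y) j z (ℕP.≤-trans (ℕP.≤-reflexive (≡.sym (ℕP.+-suc y j))) (ℕP.≤-trans g≤ (s≤s (ℕP.≤-reflexive (ℕP.+-comm z y)))))) = begin
    (y + suc j) * (y + suc j)                          ≤⟨ ℕP.m≤m+n _ _ ⟩
    (y + suc j) * (y + suc j) + (y * y + y + 2 * (j * y) + 2 * (j * t) + t * t + 2 * (t * y) + t) ≡⟨ identity y j t ⟩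
    2 * ((y + suc j) * y) + ((j + t) * (j + t) + 2 * ((j + t) * y) + (j + t)) + (y + suc j) ∎
    where
    identity : ∀ y j t → (y + suc j) * (y + suc j) + (y * y + y + 2 * (j * y) + 2 * (j * t) + t * t + 2 * (t * y) + t)
      ≡ 2 * ((y + suc j) * y) + ((j + t) * (j + t) + 2 * ((j + t) * y) + (j + t)) + (y + suc j)
    identity = solve-∀

  -- Completing squares with n = D + x turns the claim into D² ≤ L + 2a′g + x² + x + D. With e = D -
  -- g and n′ = e + s, the induction hypothesis becomes e² ≤ L + s² + s + e. As s ≤ x - (a - a′),
  -- what remains is `square-bound`, with 2zμ to spare.
  induction-step : ∀ {D g a a′ μ n′ L} → D ≤ g + a′ → D ≤ 1 + a → a′ ≤ a → n′ ≤ a′ + μ → D ∸ g ≤ n′ →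
    n′ * (2 * (D ∸ g)) ≤ L + (n′ * n′ + n′) →
    let n = a + (g + μ) in n * (2 * D) ≤ (L + (a′ * g + a′ * g)) + (n * n + n)
  induction-step {D} {g} {a} {a′} {μ} {n′} {L} D≤g+a′ D≤1+a a′≤a n′≤ e≤n′ ih with D ℕP.<? g
  -- The two faces alone give 2D ≤ n here: add D ≤ 1 + a and D + 1 ≤ g.
  ... | yes D<g = begin
    n * (2 * D)                                   ≤⟨ ℕP.*-monoʳ-≤ n 2D≤n ⟩
    n * n                                         ≤⟨ ℕP.m≤m+n _ n ⟩
    n * n + n                                     ≤⟨ ℕP.m≤n+m _ (L + (a′ * g + a′ * g)) ⟩
    (L + (a′ * g + a′ * g)) + (n * n + n)         ∎
    where
    n = a + (g + μ)
    2D≤n : 2 * D ≤ n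
    2D≤n = ℕP.+-cancelˡ-≤ 1 _ _ (begin
      1 + 2 * D          ≡⟨ double D ⟩
      D + suc D          ≤⟨ ℕP.+-mono-≤ D≤1+a D<g ⟩
      1 + a + g          ≤⟨ ℕP.m≤m+n _ μ ⟩
      1 + a + g + μ      ≡⟨ ℕP.+-assoc (1 + a) g μ ⟩
      1 + (a + (g + μ))  ∎)
      where
      double : ∀ D → 1 + 2 * D ≡ D + suc D
      double = solve-∀
  ... | no D≮g with e , ≡.refl ← ℕP.m≤n⇒∃[o]m+o≡n (ℕP.≮⇒≥ D≮g)
    with y , ≡.refl ← ℕP.m≤n⇒∃[o]m+o≡n (ℕP.+-cancelˡ-≤ g e a′ D≤g+a′)
    with z , ≡.refl ← ℕP.m≤n⇒∃[o]m+o≡n a′≤a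
    with s , ≡.refl ← ℕP.m≤n⇒∃[o]m+o≡n (ℕP.≤-trans (ℕP.≤-reflexive (≡.sym (ℕP.m+n∸m≡n g e))) e≤n′) = begin
    (e + y + z + (g + μ)) * (2 * (g + e))                                        ≡⟨ lhs e g y z μ ⟩
    e * e + g * g + K                                                            ≤⟨ ℕP.+-monoˡ-≤ K (ℕP.+-mono-≤ e²≤ (square-bound g y z g≤)) ⟩
    (L + ((y + μ) * (y + μ) + (y + μ) + e)) + (2 * (g * y) + (z * z + 2 * (z * y) + z) + g) + K
                                                                                 ≤⟨ ℕP.m≤m+n _ (2 * (z * μ)) ⟩
    (L + ((y + μ) * (y + μ) + (y + μ) + e)) + (2 * (g * y) + (z * z + 2 * (z * y) + z) + g) + K + 2 * (z * μ)
                                                                                 ≡⟨ rhs e g y z μ L ⟩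
    (L + ((e + y) * g + (e + y) * g)) + ((e + y + z + (g + μ)) * (e + y + z + (g + μ)) + (e + y + z + (g + μ))) ∎
    where
    x K : ℕ
    x = z + (y + μ)
    K = 2 * (e * g) + ((e + g) * (e + g) + 2 * ((e + g) * x))
    lhs : ∀ e g y z μ → (e + y + z + (g + μ)) * (2 * (g + e)) ≡
      e * e + g * g + (2 * (e * g) + ((e + g) * (e + g) + 2 * ((e + g) * (z + (y + μ)))))
    lhs = solve-∀
    rhs : ∀ e g y z μ L →
      (L + ((y + μ) * (y + μ) + (y + μ) + e)) + (2 * (g * y) + (z * z + 2 * (z * y) + z) + g)
        + (2 * (e * g) + ((e + g) * (e + g) + 2 * ((e + g) * (z + (y + μ))))) + 2 * (z * μ)
      ≡ (L + ((e + y) * g + (e + y) * g)) + ((e + y + z + (g + μ)) * (e + y + z + (g + μ)) + (e + y + z + (g + μ)))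
    rhs = solve-∀
    g≤ : g ≤ 1 + (z + y)
    g≤ = ℕP.+-cancelʳ-≤ e g (1 + (z + y)) (ℕP.≤-trans D≤1+a (ℕP.≤-reflexive (shuffle e y z)))
      where
      shuffle : ∀ e y z → 1 + (e + y + z) ≡ 1 + (z + y) + e
      shuffle = solve-∀
    s≤ : s ≤ y + μ
    s≤ = ℕP.+-cancelˡ-≤ e s (y + μ) (ℕP.≤-trans n′≤ (ℕP.≤-reflexive (ℕP.+-assoc e y μ)))
    e²≤ : e * e ≤ L + ((y + μ) * (y + μ) + (y + μ) + e)
    e²≤ = ℕP.≤-trans
      (ℕP.+-cancelʳ-≤ (e * e + 2 * (e * s)) (e * e) (L + (s * s + s + e)) (begin
        e * e + (e * e + 2 * (e * s))                 ≡⟨ left e s ⟩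
        (e + s) * (2 * e)                             ≡⟨ ≡.cong (λ k → (e + s) * (2 * k)) (ℕP.m+n∸m≡n g e) ⟨
        (e + s) * (2 * (g + e ∸ g))                   ≤⟨ ih ⟩
        L + ((e + s) * (e + s) + (e + s))             ≡⟨ right e s L ⟩
        L + (s * s + s + e) + (e * e + 2 * (e * s))   ∎))
      (ℕP.+-monoʳ-≤ L (ℕP.+-monoˡ-≤ e (ℕP.+-mono-≤ (ℕP.*-mono-≤ s≤ s≤) s≤)))
      where
      left : ∀ e s → e * e + (e * e + 2 * (e * s)) ≡ (e + s) * (2 * e)
      left = solve-∀
      right : ∀ e s L → L + ((e + s) * (e + s) + (e + s)) ≡ L + (s * s + s + e) + (e * e + 2 * (e * s))
      right = solve-∀

-- With coefficients in R itself the solver could not reduce x - x to 0.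
module IntegerSolver (R : CommutativeRing 0ℓ 0ℓ) where
  open CommutativeRing R hiding (zero)
  open import Algebra.Properties.Ring ring
  open import Algebra.Properties.AbelianGroup +-abelianGroup using (⁻¹-∙-comm)
  open import Algebra.Properties.Semiring.Mult semiring using (×-homo-+) renaming (_×_ to infixr 8 _·_)
  open import Relation.Binary.Reasoning.Setoid setoid

  fromℤ : ℤ → Carrier
  fromℤ (+ n)    = n · 1#
  fromℤ -[1+ n ] = - (suc n · 1#)

  fromℤ-⊖ : ∀ m n → fromℤ (m ℤ.⊖ n) ≈ m · 1# - n · 1#
  fromℤ-⊖ m       zero    = sym (trans (+-congˡ -0#≈0#) (+-identityʳ _))
  fromℤ-⊖ zero    (suc n) = sym (+-identityˡ _)
  fromℤ-⊖ (suc m) (suc n) = begin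
    fromℤ (suc m ℤ.⊖ suc n)                     ≡⟨ ≡.cong fromℤ (ℤP.[1+m]⊖[1+n]≡m⊖n m n) ⟩
    fromℤ (m ℤ.⊖ n)                             ≈⟨ fromℤ-⊖ m n ⟩
    m · 1# - n · 1#                             ≈⟨ +-congʳ (trans (sym (+-identityʳ _)) (+-congˡ (sym (-‿inverseʳ 1#)))) ⟩
    (m · 1# + (1# - 1#)) - n · 1#               ≈⟨ +-congʳ (sym (+-assoc _ _ _)) ⟩
    ((m · 1# + 1#) - 1#) - n · 1#               ≈⟨ +-assoc _ _ _ ⟩
    (m · 1# + 1#) + (- 1# - n · 1#)             ≈⟨ +-cong (+-comm _ _) (⁻¹-∙-comm _ _) ⟩
    suc m · 1# - suc n · 1#                     ∎

  fromℤ-neg : ∀ i → fromℤ (ℤ.- i) ≈ - fromℤ i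
  fromℤ-neg (+ zero)  = sym -0#≈0#
  fromℤ-neg (+ suc n) = refl
  fromℤ-neg -[1+ n ]  = sym (-‿involutive _)

  fromℤ-+ : ∀ i j → fromℤ (i ℤ.+ j) ≈ fromℤ i + fromℤ j
  fromℤ-+ (+ m)    (+ n)    = ×-homo-+ 1# m n
  fromℤ-+ (+ m)    -[1+ n ] = fromℤ-⊖ m (suc n)
  fromℤ-+ -[1+ m ] (+ n)    = trans (fromℤ-⊖ n (suc m)) (+-comm _ _)
  fromℤ-+ -[1+ m ] -[1+ n ] = begin
    - (suc (suc (m ℕ.+ n)) · 1#)   ≡⟨ ≡.cong (λ k → - (suc k · 1#)) (≡.sym (ℕP.+-suc m n)) ⟩
    - ((suc m ℕ.+ suc n) · 1#)     ≈⟨ -‿cong (×-homo-+ 1# (suc m) (suc n)) ⟩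
    - (suc m · 1# + suc n · 1#)    ≈⟨ sym (⁻¹-∙-comm _ _) ⟩
    - (suc m · 1#) - suc n · 1#    ∎

  fromℤ-+* : ∀ m j → fromℤ (+ m ℤ.* j) ≈ m · 1# * fromℤ j
  fromℤ-+* zero    j = sym (zeroˡ _)
  fromℤ-+* (suc m) j = begin
    fromℤ (+ suc m ℤ.* j)               ≡⟨ ≡.cong fromℤ (ℤP.suc-* (+ m) j) ⟩
    fromℤ (j ℤ.+ + m ℤ.* j)             ≈⟨ fromℤ-+ j (+ m ℤ.* j) ⟩
    fromℤ j + fromℤ (+ m ℤ.* j)         ≈⟨ +-cong (sym (*-identityˡ _)) (fromℤ-+* m j) ⟩
    1# * fromℤ j + m · 1# * fromℤ j     ≈⟨ sym (distribʳ _ _ _) ⟩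
    suc m · 1# * fromℤ j                ∎
  fromℤ-* : ∀ i j → fromℤ (i ℤ.* j) ≈ fromℤ i * fromℤ j
  fromℤ-* (+ m)    j = fromℤ-+* m j
  fromℤ-* -[1+ m ] j = begin
    fromℤ (-[1+ m ] ℤ.* j)             ≡⟨ ≡.cong fromℤ (≡.sym (ℤP.neg-distribˡ-* (+ suc m) j)) ⟩
    fromℤ (ℤ.- (+ suc m ℤ.* j))        ≈⟨ fromℤ-neg (+ suc m ℤ.* j) ⟩
    - fromℤ (+ suc m ℤ.* j)            ≈⟨ -‿cong (fromℤ-+* (suc m) j) ⟩
    - (suc m · 1# * fromℤ j)           ≈⟨ -‿distribˡ-* _ _ ⟩
    - (suc m · 1#) * fromℤ j           ∎

  morphism : ℤ.+-*-rawRing -Raw-AlmostCommutative⟶ fromCommutativeRing R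
  morphism = record
    { ⟦_⟧    = fromℤ
    ; +-homo = fromℤ-+
    ; *-homo = fromℤ-*
    ; -‿homo = fromℤ-neg
    ; 0-homo = refl
    ; 1-homo = +-identityʳ 1#
    }

  fromℤ-≟ : ∀ i j → Maybe (fromℤ i ≈ fromℤ j)
  fromℤ-≟ i j with i ℤ.≟ j
  ... | yes ≡.refl = just refl
  ... | no  _      = nothing

  open Algebra.Solver.Ring ℤ.+-*-rawRing (fromCommutativeRing R) morphism fromℤ-≟ public
    using (solve; _:=_; _:+_; _:*_; :-_; _:-_)

-- Ordered fields and lexicographic perturbation

module OrderedField (em : ExcludedMiddle 0ℓ) (ℝ : Reals) where
  open Reals ℝ hiding (zero)
  open IsTotalOrder isTotalOrder public
    using (antisym; total)
    renaming (refl to ≤-refl; reflexive to ≤-reflexive; trans to ≤-trans)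
  open import Algebra.Properties.Ring ring using (-0#≈0#)
  open IntegerSolver commutativeRing

  infix 4 _<_ _≢0

  _<_ : Carrier → Carrier → Set
  x < y = ¬ (y ≤ x)

  _≢0 : Carrier → Set
  x ≢0 = ¬ (x ≈ 0#)

  ≤-respˡ : ∀ {x y z} → x ≈ y → x ≤ z → y ≤ z
  ≤-respˡ x≈y x≤z = ≤-trans (≤-reflexive (sym x≈y)) x≤z

  ≤-respʳ : ∀ {x y z} → x ≈ y → z ≤ x → z ≤ y
  ≤-respʳ x≈y z≤x = ≤-trans z≤x (≤-reflexive x≈y)

  <⇒≤ : ∀ {x y} → x < y → x ≤ y
  <⇒≤ {x} {y} x<y with total x y
  ... | inj₁ x≤y = x≤y
  ... | inj₂ y≤x = contradiction y≤x x<y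

  <-≤-trans : ∀ {x y z} → x < y → y ≤ z → x < z
  <-≤-trans x<y y≤z z≤x = x<y (≤-trans y≤z z≤x)

  ≤-<-trans : ∀ {x y z} → x ≤ y → y < z → x < z
  ≤-<-trans x≤y y<z z≤x = y<z (≤-trans z≤x x≤y)

  <-irrefl : ∀ {x y} → x ≈ y → ¬ (x < y)
  <-irrefl x≈y x<y = x<y (≤-reflexive (sym x≈y))

  <⇒≉ : ∀ {x y} → x < y → ¬ (x ≈ y)
  <⇒≉ x<y x≈y = <-irrefl x≈y x<y

  ≤∧≉⇒< : ∀ {x y} → x ≤ y → ¬ (x ≈ y) → x < y
  ≤∧≉⇒< x≤y x≉y y≤x = x≉y (antisym x≤y y≤x)

  ≮⇒≥ : ∀ {x y} → ¬ (x < y) → y ≤ x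
  ≮⇒≥ = decidable-stable em

  ≤⇒<⊎≈ : ∀ {x y} → x ≤ y → x < y ⊎ x ≈ y
  ≤⇒<⊎≈ {x} {y} x≤y with em {y ≤ x}
  ... | yes y≤x = inj₂ (antisym x≤y y≤x)
  ... | no  y≰x = inj₁ y≰x

  +-monoʳ-≤ : ∀ z {x y} → x ≤ y → z + x ≤ z + y
  +-monoʳ-≤ z x≤y = ≤-respˡ (+-comm _ _) (≤-respʳ (+-comm _ _) (+-monoˡ-≤ z x≤y))

  +-mono-≤ : ∀ {x y u v} → x ≤ y → u ≤ v → x + u ≤ y + v
  +-mono-≤ x≤y u≤v = ≤-trans (+-monoˡ-≤ _ x≤y) (+-monoʳ-≤ _ u≤v)

  ≤⇒0≤- : ∀ {x y} → x ≤ y → 0# ≤ y - x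
  ≤⇒0≤- {x} x≤y = ≤-respˡ (-‿inverseʳ x) (+-monoˡ-≤ (- x) x≤y)

  0≤-⇒≤ : ∀ {x y} → 0# ≤ y - x → x ≤ y
  0≤-⇒≤ {x} {y} p = ≤-respˡ (+-identityˡ x) (≤-respʳ lemma (+-monoˡ-≤ x p))
    where lemma = solve 2 (λ x y → (y :- x) :+ x := y) refl x y

  neg-mono-≤ : ∀ {x y} → x ≤ y → - y ≤ - x
  neg-mono-≤ {x} {y} x≤y = 0≤-⇒≤ (≤-respʳ (solve 2 (λ x y → y :- x := (:- x) :- (:- y)) refl x y) (≤⇒0≤- x≤y))

  neg-cancel-≤ : ∀ {x y} → - x ≤ - y → y ≤ x
  neg-cancel-≤ {x} {y} p = 0≤-⇒≤ (≤-respʳ (solve 2 (λ x y → (:- y) :- (:- x) := x :- y) refl x y) (≤⇒0≤- p))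

  +-cancelˡ-≤ : ∀ z {x y} → z + x ≤ z + y → x ≤ y
  +-cancelˡ-≤ z {x} {y} p = 0≤-⇒≤ (≤-respʳ (solve 3 (λ x y z → (z :+ y) :- (z :+ x) := y :- x) refl x y z) (≤⇒0≤- p))

  *-monoʳ-≤ : ∀ {z x y} → 0# ≤ z → x ≤ y → z * x ≤ z * y
  *-monoʳ-≤ {z} {x} {y} 0≤z x≤y =
    0≤-⇒≤ (≤-respʳ (solve 3 (λ x y z → z :* (y :- x) := (z :* y) :- (z :* x)) refl x y z) (*-nonNeg 0≤z (≤⇒0≤- x≤y)))

  integral : ∀ {x y} → x ≢0 → x * y ≈ 0# → y ≈ 0#
  integral {x} {y} x≢0 xy≈0 with z , xz≈1 ← inverse x x≢0 = begin
    y            ≈⟨ sym (*-identityˡ y) ⟩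
    1# * y       ≈⟨ *-congʳ (sym xz≈1) ⟩
    x * z * y    ≈⟨ solve 3 (λ x y z → (x :* z) :* y := z :* (x :* y)) refl x y z ⟩
    z * (x * y)  ≈⟨ *-congˡ xy≈0 ⟩
    z * 0#       ≈⟨ zeroʳ z ⟩
    0#           ∎
    where open import Relation.Binary.Reasoning.Setoid setoid

  0<1 : 0# < 1#
  0<1 1≤0 = 0≉1 (antisym 0≤1 1≤0)
    where
    0≤-1 : 0# ≤ - 1#
    0≤-1 = ≤-respˡ -0#≈0# (neg-mono-≤ 1≤0)
    0≤1 : 0# ≤ 1#
    0≤1 = ≤-respʳ (trans (solve 1 (λ x → (:- x) :* (:- x) := x :* x) refl 1#) (*-identityˡ 1#)) (*-nonNeg 0≤-1 0≤-1)

  <⇒0<- : ∀ {x y} → x < y → 0# < y - x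
  <⇒0<- {x} {y} x<y y-x≤0 = x<y (≤-respʳ (+-identityˡ x) (≤-respˡ (solve 2 (λ x y → (y :- x) :+ x := y) refl x y) (+-monoˡ-≤ x y-x≤0)))

  0<-⇒< : ∀ {x y} → 0# < y - x → x < y
  0<-⇒< 0<y-x y≤x = 0<y-x (≤-respʳ (-‿inverseʳ _) (+-monoˡ-≤ _ y≤x))

  neg-mono-< : ∀ {x y} → x < y → - y < - x
  neg-mono-< x<y = λ -x≤-y → x<y (neg-cancel-≤ -x≤-y)

  totalOrder : TotalOrder 0ℓ 0ℓ 0ℓ
  totalOrder = record { isTotalOrder = isTotalOrder }

  open Data.List.Extrema totalOrder using (argmax; argmax-sel; f[xs]≤f[argmax])

  maximiser : ∀ {a} {A : Set a} (f : A → Carrier) {y : A} {xs} → y ∈ˡ xs →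
    ∃[ x ] x ∈ˡ xs × (∀ {z} → z ∈ˡ xs → f z ≤ f x)
  maximiser f {y} {xs} y∈xs = argmax f y xs , member , All.lookup (f[xs]≤f[argmax] y xs)
    where
    member : argmax f y xs ∈ˡ xs
    member with argmax-sel f y xs
    ... | inj₁ eq = ≡.subst (_∈ˡ xs) (≡.sym eq) y∈xs
    ... | inj₂ p  = p

  Eventually : (Carrier → Set) → Set
  Eventually P = ∃[ M ] ∀ {M′} → M ≤ M′ → P M′

  eventually-all : ∀ {n} {P : Fin n → Carrier → Set} →
    (∀ i → Eventually (P i)) → Eventually (λ M → ∀ i → P i M)
  eventually-all {zero}  ev = 0# , λ _ ()
  eventually-all {suc n} ev with M , p ← ev zero | M′ , p′ ← eventually-all (λ i → ev (suc i)) with total M M′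
  ... | inj₁ M≤M′ = M′ , λ { le zero → p (≤-trans M≤M′ le) ; le (suc i) → p′ le i }
  ... | inj₂ M′≤M = M  , λ { le zero → p le ; le (suc i) → p′ (≤-trans M′≤M le) i }

  -- The threshold `M` solves (w j - w i) M = (v i - v j) + (w j - w i), so from there on the right
  -- side leads by at least w j - w i.
  lexicographic-pair : ∀ {n} (w v : Fin n → Carrier) i j →
    Eventually (λ M → w i < w j → M * w i + v i < M * w j + v j)
  lexicographic-pair w v i j with em {w i < w j}
  ... | no  w≮ = 0# , λ _ w< → contradiction w< w≮
  ... | yes w< with z , az≈1 ← inverse (w j - w i) (λ eq → <⇒≉ (<⇒0<- w<) (sym eq)) =
    (v i - v j) * z + 1# , λ {M′} M≤M′ _ → 0<-⇒< (<-≤-trans (<⇒0<- w<) (main M′ M≤M′))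
    where
    open import Relation.Binary.Reasoning.Setoid setoid
    a b : Carrier
    a = w j - w i
    b = v i - v j
    eq : (b * z + 1#) * a - b ≈ a
    eq = begin
      (b * z + 1#) * a - b    ≈⟨ solve 4 (λ a b z e → (b :* z :+ e) :* a :- b := b :* (a :* z) :+ e :* a :- b) refl a b z 1# ⟩
      b * (a * z) + 1# * a - b ≈⟨ +-congʳ (+-cong (trans (*-congˡ az≈1) (*-identityʳ b)) (*-identityˡ a)) ⟩
      b + a - b               ≈⟨ solve 2 (λ a b → b :+ a :- b := a) refl a b ⟩
      a                       ∎
    main : ∀ M′ → b * z + 1# ≤ M′ → a ≤ (M′ * w j + v j) - (M′ * w i + v i)
    main M′ le = ≤-respˡ eq (≤-respʳ
      (solve 5 (λ m wi wj vi vj → (wj :- wi) :* m :- (vi :- vj) := (m :* wj :+ vj) :- (m :* wi :+ vi)) refl M′ (w i) (w j) (v i) (v j))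
      (+-monoˡ-≤ (- b) (≤-respˡ (*-comm _ _) (*-monoʳ-≤ (<⇒≤ (<⇒0<- w<)) le))))

  -- A stand-in for adding an infinitesimal multiple of `v` to `w`: ties of `w` are broken by `v`
  -- and nothing else changes. One `M` serves because there are finitely many pairs of indices.
  lexicographic : ∀ {n} (w v : Fin n → Carrier) →
    ∃[ M ] ∀ {i j} → w i < w j → M * w i + v i < M * w j + v j
  lexicographic w v
    with M , p ← eventually-all (λ i → eventually-all (λ j → lexicographic-pair w v i j))
    = M , λ {i} {j} → p ≤-refl i j

-- Configurations: exposed points, domination and facets

module Configuration (em : ExcludedMiddle 0ℓ) (ℝ : Reals) (N : ℕ) where
  open Reals ℝ hiding (zero)
  open OrderedField em ℝ
  open IntegerSolver commutativeRing
  open import Algebra.Properties.Ring ring using (-0#≈0#)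
  open Lists

  Functional : Set
  Functional = Fin N → Carrier

  -- The affine functionals on a configuration of N points, restricted to the
  -- points.
  record Functionals : Set₁ where
    field
      member  : Pred Functional 0ℓ
      combine : ∀ {w v} → w ∈ member → v ∈ member → ∀ M → (λ i → M * w i + v i) ∈ member
      negate  : ∀ {w} → w ∈ member → (λ i → - w i) ∈ member
      shift   : ∀ {w} → w ∈ member → ∀ c → (λ i → w i + c) ∈ member
  open Functionals public

  StrictTop : Functional → List (Fin N) → Fin N → Set
  StrictTop w S i = ∀ {l} → l ∈ˡ S → l ≢ i → w l < w i

  Exposed : Functionals → List (Fin N) → Set
  Exposed U S = ∀ {i} → i ∈ˡ S → ∃[ w ] w ∈ member U × StrictTop w S i

  Antipodal : Functionals → List (Fin N) → Fin N → Fin N → Set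
  Antipodal U S i j = ∃[ w ] w ∈ member U × w j < w i × StrictTop w S i × StrictTop (λ l → - w l) S j

  Antipodal-sym : ∀ {U S i j} → Antipodal U S i j → Antipodal U S j i
  Antipodal-sym {U} (w , w∈ , wj<wi , top , bottom) =
    (λ l → - w l) , negate U w∈ , neg-mono-< wj<wi , bottom , λ l∈ l≢ → neg-mono-< (neg-mono-< (top l∈ l≢))

  -- No point of R lies outside the convex hull of R′.
  Dominates : Functionals → List (Fin N) → List (Fin N) → Set
  Dominates U R′ R = ∀ {w} → w ∈ member U → ∀ {j} → j ∈ˡ R → ∃[ i ] i ∈ˡ R′ × w j ≤ w i

  Top Bottom : Functional → List (Fin N) → Fin N → Set
  Top    w S i = ∀ {l} → l ∈ˡ S → w l ≤ w i
  Bottom w S i = ∀ {l} → l ∈ˡ S → w i ≤ w l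

  tied-< : ∀ {a b x y} → a ≈ b → x < y → a + x < b + y
  tied-< {a} a≈b x<y le = x<y (+-cancelˡ-≤ a (≤-respˡ (+-congʳ (sym a≈b)) le))

  -- Subtracting `v`, which exposes `q`, shrinks the bottom face of `w` to `q`. A maximiser `p` of
  -- the result is still on the top face of `w`, and adding `v′`, which exposes `p`, makes it the
  -- only maximiser. Each correction is lexicographically subordinate to what precedes it, so strict
  -- inequalities already gained survive.
  oppose : ∀ U {S w p₀ q} → Exposed U S → w ∈ member U → q ∈ˡ S → Bottom w S q →
    p₀ ∈ˡ S → w q < w p₀ →
    ∃[ p ] p ∈ˡ S × Top w S p × Antipodal U S p q
  oppose U {S} {w} {p₀} {q} exposed w∈ q∈ bottom p₀∈ q<p₀
    with v , v∈ , vtop ← exposed q∈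
    with M , lex ← lexicographic w (λ i → - v i)
    with p , p∈ , pmax ← maximiser (λ i → M * w i + - v i) q∈
    with v′ , v′∈ , v′top ← exposed p∈
    with M′ , lex′ ← lexicographic (λ i → M * w i + - v i) v′
    = p , p∈ , top
    , (λ i → M′ * (M * w i + - v i) + v′ i) , combine U (combine U w∈ (negate U v∈) M) v′∈ M′
    , lex′ (lex (<-≤-trans q<p₀ (top p₀∈)))
    , strict
    , λ l∈ l≢q → neg-mono-< (lex′ (bottom′ l∈ l≢q))
    where
    top : Top w S p
    top l∈ = ≮⇒≥ λ p<l → lex p<l (pmax l∈)
    strict : StrictTop _ S p
    strict l∈ l≢p with ≤⇒<⊎≈ (pmax l∈)
    ... | inj₁ l<p = lex′ l<p
    ... | inj₂ l≈p = tied-< (*-congˡ l≈p) (v′top l∈ l≢p)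
    bottom′ : ∀ {l} → l ∈ˡ S → l ≢ q → M * w q + - v q < M * w l + - v l
    bottom′ l∈ l≢q with ≤⇒<⊎≈ (bottom l∈)
    ... | inj₁ q<l = lex q<l
    ... | inj₂ q≈l = tied-< (*-congˡ q≈l) (neg-mono-< (vtop l∈ l≢q))

  -- For large `M` only `i` can dominate `j` under `M * w + v`, since every other point of `R′`
  -- already falls short in `w`. As `w i` and `w j` agree, the comparison passes to `v`.
  above-vertex : ∀ U {R′ R w i j} → Dominates U R′ R → w ∈ member U → StrictTop w R′ i →
    j ∈ˡ R → w i ≤ w j → ∀ {v} → v ∈ member U → v j ≤ v i
  above-vertex U {w = w} {i} {j} dom w∈ strict j∈ i≤j {v} v∈
    with M , lex ← lexicographic w v
    with k , k∈ , j≤k ← dom (combine U w∈ v∈ M) j∈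
    with k′ , k′∈ , j≤k′ ← dom w∈ j∈
    with k ≟ i
  ... | no  k≢i = contradiction j≤k (lex (<-≤-trans (strict k∈ k≢i) i≤j))
  ... | yes ≡.refl = +-cancelˡ-≤ (M * w j) (≤-respʳ (+-congʳ (*-congˡ (antisym i≤j wj≤wi))) j≤k)
    where
    wj≤wi : w j ≤ w i
    wj≤wi with k′ ≟ i
    ... | yes ≡.refl = j≤k′
    ... | no  k′≢i   = ≤-trans j≤k′ (<⇒≤ (strict k′∈ k′≢i))

  -- This shows that a maximiser found after a perturbation has the same image under the projection
  -- as the vertex it came from.
  same-as-vertex : ∀ U {R′ R w i j} → Dominates U R′ R → w ∈ member U → StrictTop w R′ i →
    j ∈ˡ R → w i ≤ w j → ∀ {v} → v ∈ member U → v j ≈ v i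
  same-as-vertex U dom w∈ strict j∈ i≤j v∈ =
    antisym (above-vertex U dom w∈ strict j∈ i≤j v∈)
            (neg-cancel-≤ (above-vertex U dom w∈ strict j∈ i≤j (negate U v∈)))

  -- An inclusion-minimal dominating set is exposed; this replaces passing to
  -- the vertex set.
  minimise : ∀ U R {R₀} → Unique R₀ → Dominates U R₀ R →
    ∃[ R′ ] R′ ⊆ˡ R₀ × Unique R′ × Dominates U R′ R × Exposed U R′
  minimise U R {R₀} = go (<-wellFounded (length R₀))
    where
    go : ∀ {R₀} → Acc ℕ._<_ (length R₀) → Unique R₀ → Dominates U R₀ R →
      ∃[ R′ ] R′ ⊆ˡ R₀ × Unique R′ × Dominates U R′ R × Exposed U R′
    go {R₀} (acc rec) uniq dom with em {∃[ i ] i ∈ˡ R₀ × ¬ (∃[ w ] w ∈ member U × StrictTop w R₀ i)}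
    ... | no  none = R₀ , (λ r → r) , uniq , dom , λ i∈ → decidable-stable em (λ not → none (_ , i∈ , not))
    ... | yes (i , i∈ , hidden) =
      let R′ , R′⊆ , rest = go (rec shorter) (UniqueP.filter⁺ keep? uniq) dom′
      in R′ , (λ r → proj₁ (∈-filter⁻ keep? (R′⊆ r))) , rest
      where
      keep? = λ l → ¬? (l ≟ i)
      shorter : length (filter keep? R₀) ℕ.< length R₀
      shorter = ListP.filter-notAll keep? R₀ (lose i∈ (λ i≢i → i≢i ≡.refl))
      dom′ : Dominates U (filter keep? R₀) R
      -- A functional with `j` above all the kept points can only be matched at `i`, by domination,
      -- and so it would expose `i` after all.
      dom′ {w} w∈ {j} j∈ = decidable-stable em λ none →
        let below : ∀ {l} → l ∈ˡ R₀ → l ≢ i → w l < w j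
            below l∈ l≢i j≤l = none (_ , ∈-filter⁺ keep? l∈ l≢i , j≤l)
            k , k∈ , j≤k = dom w∈ j∈
            j≤i = decidable-stable em λ j≰i → below k∈ (λ { ≡.refl → j≰i j≤k }) j≤k
        in hidden (w , w∈ , λ l∈ l≢i → <-≤-trans (below l∈ l≢i) j≤i)

  data Constraint : Set where
    vanish : Fin N → Constraint
    tie    : Fin N → Fin N → Constraint

  Satisfies : Functional → Constraint → Set
  Satisfies w (vanish i) = w i ≈ 0#
  Satisfies w (tie i j)  = w i ≈ w j

  -- The functionals span a space of dimension at least D on S.
  Rich : Functionals → List (Fin N) → ℕ → Set
  Rich U S D = ∀ cs → length cs ℕ.< D →
    ∃[ w ] w ∈ member U × All (Satisfies w) cs × ∃[ s ] s ∈ˡ S × w s ≢0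

  top? : ∀ u S i → _
  top? u S i = em {Top u S i}

  bottom? : ∀ u S i → _
  bottom? u S i = em {Bottom u S i}

  -- Expresses that the top face has codimension one: its points and the single point `q` determine
  -- a functional on `S`.
  Rigid : Functionals → List (Fin N) → Functional → Fin N → Set
  Rigid U S u q = ∀ {w} → w ∈ member U → (∀ {p} → p ∈ˡ S → Top u S p → w p ≈ 0#) → w q ≈ 0# →
    ∀ {l} → l ∈ˡ S → w l ≈ 0#

  record Facet (U : Functionals) (S : List (Fin N)) : Set where
    field
      u      : Functional
      u∈     : u ∈ member U
      p q    : Fin N
      p∈     : p ∈ˡ S
      q∈     : q ∈ˡ S
      top    : Top u S p
      bottom : Bottom u S q
      q<p    : u q < u p
      rigid  : Rigid U S u q

  -- Total, with value 0 at 0, so that the quotient minimised in `rotate` is defined at every index.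
  reciprocal : Carrier → Carrier
  reciprocal x with em {x ≈ 0#}
  ... | yes _   = 0#
  ... | no  x≢0 = proj₁ (inverse x x≢0)

  *-reciprocal : ∀ {x} → x ≢0 → x * reciprocal x ≈ 1#
  *-reciprocal {x} x≢0 with em {x ≈ 0#}
  ... | yes x≈0 = contradiction x≈0 x≢0
  ... | no  x≢0 = proj₂ (inverse x x≢0)

  -- Rotating a supporting hyperplane about the points it contains until it
  -- meets a new one.
  rotate : ∀ U {S u p q} → u ∈ member U → p ∈ˡ S → q ∈ˡ S → Top u S p → u q < u p →
    ∀ {w l₁} → w ∈ member U → (∀ {p} → p ∈ˡ S → Top u S p → w p ≈ 0#) → w q ≈ 0# → l₁ ∈ˡ S → w l₁ ≢0 →
    ∃[ u′ ] u′ ∈ member U × (∃[ l₀ ] l₀ ∈ˡ S × u l₀ < u p × Top u′ S l₀) ×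
      (∀ {i} → i ∈ˡ S → Top u S i → Top u′ S i) × (∃[ i ] i ∈ˡ S × u′ i < u′ p)
  rotate U {S} {u} {p} {q} u∈ p∈ q∈ top q<p {w} {l₁} w∈ w-top wq≈0 l₁∈ wl₁≢0
    -- The ratio test of the simplex method: among the points below the face, `l₀` minimises w / (u
    -- - u p) and is thus the first point met by the rotating hyperplane.
    with l₀ , l₀∈low , least ← maximiser (λ l → - (w l * reciprocal (u l + - u p))) (∈-filter⁺ (λ l → em {u l < u p}) q∈ q<p)
    with l₀∈ , l₀<p ← ∈-filter⁻ (λ l → em {u l < u p}) {xs = S} l₀∈low
    = u′ , combine U (shift U u∈ (- u p)) w∈ (- ratio l₀)
    , (l₀ , l₀∈ , l₀<p , λ l∈ → ≤-respʳ (sym u′l₀≈0) (u′≤0 l∈))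
    , (λ i∈ itop l∈ → ≤-respʳ (sym (u′-top i∈ itop)) (u′≤0 l∈))
    , nonconstant
    where
    open import Relation.Binary.Reasoning.Setoid setoid
    u₀ ratio u′ : Functional
    u₀ l = u l + - u p
    ratio l = w l * reciprocal (u₀ l)
    u′ l = (- ratio l₀) * u₀ l + w l
    u₀≢0 : ∀ {l} → u l < u p → u₀ l ≢0
    u₀≢0 {l} l<p eq = <⇒≉ l<p (trans (solve 2 (λ x y → x := (x :+ :- y) :+ y) refl (u l) (u p)) (trans (+-congʳ eq) (+-identityˡ _)))
    u′-low : ∀ {l} → u l < u p → u′ l ≈ - ((ratio l - ratio l₀) * - u₀ l)
    u′-low {l} l<p = begin
      (- r) * u₀ l + w l                                     ≈⟨ +-congˡ (sym (*-identityʳ _)) ⟩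
      (- r) * u₀ l + w l * 1#                                ≈⟨ +-congˡ (*-congˡ (sym (*-reciprocal (u₀≢0 l<p)))) ⟩
      (- r) * u₀ l + w l * (u₀ l * reciprocal (u₀ l))        ≈⟨ rearrange r (u₀ l) (w l) (reciprocal (u₀ l)) ⟩
      - ((ratio l - r) * - u₀ l)                             ∎
      where
      r = ratio l₀
      rearrange : ∀ r u w z → (- r) * u + w * (u * z) ≈ - ((w * z - r) * - u)
      rearrange = solve 4 (λ r u w z → (:- r) :* u :+ w :* (u :* z) := :- ((w :* z :- r) :* :- u)) refl
    u′-top : ∀ {i} → i ∈ˡ S → Top u S i → u′ i ≈ 0#
    u′-top {i} i∈ itop = begin
      (- ratio l₀) * (u i + - u p) + w i   ≈⟨ +-cong (*-congˡ (+-congʳ (antisym (top i∈) (itop p∈)))) (w-top i∈ itop) ⟩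
      (- ratio l₀) * (u p + - u p) + 0#    ≈⟨ +-cong (*-congˡ (-‿inverseʳ _)) refl ⟩
      (- ratio l₀) * 0# + 0#               ≈⟨ trans (+-identityʳ _) (zeroʳ _) ⟩
      0#                                   ∎
    u′≤0 : ∀ {l} → l ∈ˡ S → u′ l ≤ 0#
    u′≤0 {l} l∈ with ≤⇒<⊎≈ (top l∈)
    ... | inj₂ l≈p = ≤-reflexive (u′-top l∈ (λ k∈ → ≤-respʳ (sym l≈p) (top k∈)))
    ... | inj₁ l<p = ≤-respˡ (sym (u′-low l<p)) (≤-respʳ -0#≈0# (neg-mono-≤ (*-nonNeg
      (≤⇒0≤- (neg-cancel-≤ (least (∈-filter⁺ (λ l → em {u l < u p}) l∈ l<p))))
      (≤-respʳ (solve 2 (λ x y → y :- x := :- (x :+ :- y)) refl (u l) (u p)) (≤⇒0≤- (<⇒≤ l<p))))))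
    u′l₀≈0 : u′ l₀ ≈ 0#
    u′l₀≈0 = trans (u′-low l₀<p)
      (trans (-‿cong (trans (*-congʳ (-‿inverseʳ _)) (zeroˡ _))) -0#≈0#)
    below : ∀ {l} → l ∈ˡ S → u′ l ≢0 → u′ l < u′ p
    below l∈ u′l≢0 = <-≤-trans (≤∧≉⇒< (u′≤0 l∈) u′l≢0) (≤-reflexive (sym (u′-top p∈ top)))
    nonconstant : ∃[ i ] i ∈ˡ S × u′ i < u′ p
    -- If the least ratio is 0, then `u′` is `w`, which is nonzero at `l₁`. Otherwise `u′` is
    -- nonzero at `q`, where `w` vanishes.
    nonconstant with em {ratio l₀ ≈ 0#}
    ... | yes r≈0 = l₁ , l₁∈ , below l₁∈ λ eq → wl₁≢0 (begin
      w l₁                        ≈⟨ +-identityˡ _ ⟨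
      0# + w l₁                   ≈⟨ +-congʳ (trans (*-congʳ (trans (-‿cong r≈0) -0#≈0#)) (zeroˡ (u₀ l₁))) ⟨
      u′ l₁                       ≈⟨ eq ⟩
      0#                          ∎)
    ... | no r≢0 = q , q∈ , below q∈ λ eq → r≢0 (integral (u₀≢0 q<p) (begin
      u₀ q * ratio l₀                 ≈⟨ rearrange (u₀ q) (ratio l₀) (w q) ⟩
      - u′ q + w q                    ≈⟨ +-cong (-‿cong eq) wq≈0 ⟩
      - 0# + 0#                       ≈⟨ -‿inverseˡ 0# ⟩
      0#                              ∎))
      where
      rearrange : ∀ x r w → x * r ≈ - ((- r) * x + w) + w
      rearrange = solve 3 (λ x r w → x :* r := :- ((:- r) :* x :+ w) :+ w) refl

  tops : Functional → List (Fin N) → List (Fin N)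
  tops u S = filter (top? u S) S

  more-tops : ∀ {S u u′ p l₀} → Unique S → p ∈ˡ S → l₀ ∈ˡ S → u l₀ < u p → Top u′ S l₀ →
    (∀ {i} → i ∈ˡ S → Top u S i → Top u′ S i) → length (tops u S) ℕ.< length (tops u′ S)
  more-tops {S} {u} {u′} uniq p∈ l₀∈ l₀<p l₀top keeps = Unique-⊆⇒length≤
    (All.tabulate (λ { l∈ ≡.refl → contradiction (proj₂ (∈-filter⁻ (top? u S) {xs = S} l∈) p∈) l₀<p })
      ∷ UniqueP.filter⁺ (top? u S) uniq)
    λ { (here ≡.refl) → ∈-filter⁺ (top? u′ S) l₀∈ l₀top
      ; (there l∈)    → let l∈S , ltop = ∈-filter⁻ (top? u S) l∈ in ∈-filter⁺ (top? u′ S) l∈S (keeps l∈S ltop) }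

  facet-or-rotate : ∀ U {S u p q} → Unique S → u ∈ member U → p ∈ˡ S → q ∈ˡ S →
    Top u S p → Bottom u S q → u q < u p →
    Facet U S ⊎ ∃[ u′ ] u′ ∈ member U × length (tops u S) ℕ.< length (tops u′ S) ×
                        ∃[ i ] i ∈ˡ S × ∃[ j ] j ∈ˡ S × u′ i < u′ j
  facet-or-rotate U {S} {u} {p} {q} uniq u∈ p∈ q∈ top bottom q<p
    with em {∃[ w ] w ∈ member U × (∀ {p} → p ∈ˡ S → Top u S p → w p ≈ 0#) × w q ≈ 0# × ∃[ l ] l ∈ˡ S × w l ≢0}
  ... | no none = inj₁ record
    { u∈ = u∈ ; p∈ = p∈ ; q∈ = q∈ ; top = top ; bottom = bottom ; q<p = q<p
    ; rigid = λ w∈ wtop wq≈0 l∈ → decidable-stable em λ wl≢0 → none (_ , w∈ , wtop , wq≈0 , _ , l∈ , wl≢0) }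
  ... | yes (w , w∈ , wtop , wq≈0 , l₁ , l₁∈ , wl₁≢0) =
    let u′ , u′∈ , (l₀ , l₀∈ , l₀<p , l₀top) , keeps , k , k∈ , k<p =
          rotate U u∈ p∈ q∈ top q<p w∈ wtop wq≈0 l₁∈ wl₁≢0
    in inj₂ (u′ , u′∈ , more-tops {u = u} uniq p∈ l₀∈ l₀<p l₀top keeps , k , k∈ , p , p∈ , k<p)

  -- `n` is fuel: every rotation enlarges the top face, which cannot outgrow `S`.
  facet-from : ∀ U {S} → Unique S → ∀ n {u i j} → u ∈ member U → i ∈ˡ S → j ∈ˡ S → u i < u j →
    length S ℕ.< length (tops u S) ℕ.+ n → Facet U S
  facet-from U {S} uniq zero {u} u∈ i∈ j∈ i<j room =
    contradiction (≡.subst (length S ℕ.<_) (ℕP.+-identityʳ _) room)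
      (ℕP.≤⇒≯ (ListP.length-filter (top? u S) S))
  facet-from U {S} uniq (suc n) {u} u∈ i∈ j∈ i<j room =
    let p , p∈ , top    = maximiser u i∈
        q , q∈ , bottom = maximiser (λ l → - u l) i∈
    in case facet-or-rotate U uniq u∈ p∈ q∈ top (λ l∈ → neg-cancel-≤ (bottom l∈))
              (≤-<-trans (neg-cancel-≤ (bottom i∈)) (<-≤-trans i<j (top j∈))) of λ
      { (inj₁ found) → found
      ; (inj₂ (u′ , u′∈ , more , k , k∈ , l , l∈ , k<l)) → facet-from U uniq n u′∈ k∈ l∈ k<l
          (ℕP.≤-trans room (ℕP.≤-trans (ℕP.≤-reflexive (ℕP.+-suc _ n)) (ℕP.+-monoˡ-≤ n more))) }

  -- Dimension at least 2 yields a functional that vanishes at some `s` of `S` but not on all of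
  -- `S`. It is not constant, so the rotations can start from it.
  facet : ∀ U {S D} → Unique S → Rich U S (2 ℕ.+ D) → Facet U S
  facet U {S} uniq rich
    with _ , _ , _ , s , s∈ , _ ← rich [] (ℕ.s≤s ℕ.z≤n)
    with w , w∈ , ws≈0 ∷ [] , t , t∈ , wt≢0 ← rich (vanish s ∷ []) (ℕ.s≤s (ℕ.s≤s ℕ.z≤n))
    with total (w s) (w t)
  ... | inj₁ s≤t = facet-from U uniq (suc (length S)) w∈ s∈ t∈
    (≤∧≉⇒< s≤t (λ eq → wt≢0 (trans (sym eq) ws≈0))) (ℕP.m≤n+m _ _)
  ... | inj₂ t≤s = facet-from U uniq (suc (length S)) w∈ t∈ s∈
    (≤∧≉⇒< t≤s (λ eq → wt≢0 (trans eq ws≈0))) (ℕP.m≤n+m _ _)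

-- The induction: merging faces and counting ordered pairs

module PairCounting (em : ExcludedMiddle 0ℓ) (ℝ : Reals) (N : ℕ) where
  open Reals ℝ hiding (zero)
  open OrderedField em ℝ
  open Configuration em ℝ N
  open Lists

  -- These are the functionals that factor through the projection collapsing `G` and `l` to one
  -- point.
  tied : Functionals → List (Fin N) → Fin N → Functionals
  tied U G l = record
    { member  = λ w → w ∈ member U × (∀ {q} → q ∈ˡ G → w q ≈ w l)
    ; combine = λ (w∈ , w-tied) (v∈ , v-tied) M →
        combine U w∈ v∈ M , λ q∈ → +-cong (*-congˡ (w-tied q∈)) (v-tied q∈)
    ; negate  = λ (w∈ , w-tied) → negate U w∈ , λ q∈ → -‿cong (w-tied q∈)
    ; shift   = λ (w∈ , w-tied) c → shift U w∈ c , λ q∈ → +-congʳ (w-tied q∈)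
    }

  vanish⁺ : ∀ {w} → (xs : List (Fin N)) → All (Satisfies w) (map vanish xs) → ∀ {x} → x ∈ˡ xs → w x ≈ 0#
  vanish⁺ xs sat x∈ = All.lookup (AllP.map⁻ sat) x∈

  Rich⇒≤length : ∀ U {S D} → Rich U S D → D ℕ.≤ length S
  Rich⇒≤length U {S} {D} rich = ℕP.≮⇒≥ λ S<D →
    let w , w∈ , sat , s , s∈ , ws≢0 = rich (map vanish S) (≡.subst (ℕ._< D) (≡.sym (ListP.length-map vanish S)) S<D)
    in ws≢0 (vanish⁺ {w} S sat s∈)

  -- Domination bounds both `w` and its negative by 0. This is how a dimension count passes from a
  -- minimal dominating set to all points.
  vanish-dominated : ∀ U {R′ R} → Dominates U R′ R → ∀ {w} → w ∈ member U → (∀ {i} → i ∈ˡ R′ → w i ≈ 0#) →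
    ∀ {j} → j ∈ˡ R → w j ≈ 0#
  vanish-dominated U dom {w} w∈ zeros {j} j∈ = antisym
    (let i , i∈ , j≤i = dom w∈ j∈ in ≤-respʳ (zeros i∈) j≤i)
    (let i , i∈ , j≤i = dom (negate U w∈) j∈ in neg-cancel-≤ (≤-respʳ (-‿cong (zeros i∈)) j≤i))

  separated : ∀ U {R} → Exposed U R → ∀ {i j} → i ∈ˡ R → j ∈ˡ R →
    (∀ {v} → v ∈ member U → v i ≈ v j) → i ≡ j
  separated U exposed {i} {j} i∈ j∈ same = decidable-stable (i ≟ j) λ i≢j →
    let w , w∈ , strict = exposed i∈
    in <⇒≉ (strict j∈ (λ j≡i → i≢j (≡.sym j≡i))) (sym (same w∈))

  below-vertex : ∀ U {R′ R} → Dominates U R′ R → ∀ {w i} → w ∈ member U → StrictTop w R′ i →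
    ∀ {l} → l ∈ˡ R → w l ≤ w i
  below-vertex U dom {w} {i} w∈ strict l∈ with k , k∈ , l≤k ← dom w∈ l∈ with k ≟ i
  ... | yes ≡.refl = l≤k
  ... | no  k≢i    = ≤-trans l≤k (<⇒≤ (strict k∈ k≢i))

  -- For D = d + 1 and |S| = d + k the bound says |L| ≥ d² - k² + d + k; it is
  -- stated without subtraction.
  AntipodalPairs : Functionals → List (Fin N) → ℕ → Set
  AntipodalPairs U S D = ∃ λ (L : List (Fin N × Fin N)) → Unique L ×
    All (λ (i , j) → i ∈ˡ S × j ∈ˡ S × Antipodal U S i j) L ×
    length S ℕ.* (2 ℕ.* D) ℕ.≤ length L ℕ.+ (length S ℕ.* length S ℕ.+ length S)

  -- F and G are the points on a facet and on the opposite face.  The points of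
  -- G are merged with a point of F, and F is replaced by the vertices F′ of
  -- its projection along the affine hull of G.
  module Merge (U : Functionals) (S : List (Fin N)) (D : ℕ) (uniq : Unique S) (exposed : Exposed U S)
               (rich : Rich U S D) (f : Facet U S) where
    open Facet f

    rest? mid? : ∀ i → _
    rest? i = ¬? (bottom? u S i)
    mid? i  = ¬? (em {Top u S i ⊎ Bottom u S i})

    F G Mid Rest : List (Fin N)
    F    = filter (top? u S) S
    G    = filter (bottom? u S) S
    Mid  = filter mid? S
    Rest = filter rest? S

    F⊆S : F ⊆ˡ S
    F⊆S i∈ = proj₁ (∈-filter⁻ (top? u S) i∈)
    G⊆S : G ⊆ˡ S
    G⊆S i∈ = proj₁ (∈-filter⁻ (bottom? u S) i∈)
    Rest⊆S : Rest ⊆ˡ S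
    Rest⊆S i∈ = proj₁ (∈-filter⁻ rest? i∈)
    Mid⊆S : Mid ⊆ˡ S
    Mid⊆S i∈ = proj₁ (∈-filter⁻ mid? i∈)
    F-top : ∀ {i} → i ∈ˡ F → Top u S i
    F-top i∈ = proj₂ (∈-filter⁻ (top? u S) {xs = S} i∈)
    G-bottom : ∀ {i} → i ∈ˡ G → Bottom u S i
    G-bottom i∈ = proj₂ (∈-filter⁻ (bottom? u S) {xs = S} i∈)
    p∈F : p ∈ˡ F
    p∈F = ∈-filter⁺ (top? u S) p∈ top
    q∈G : q ∈ˡ G
    q∈G = ∈-filter⁺ (bottom? u S) q∈ bottom

    top⇒¬bottom : ∀ {i} → Top u S i → ¬ Bottom u S i
    top⇒¬bottom itop ibottom = q<p (≤-trans (itop p∈) (ibottom q∈))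

    F⊆Rest : F ⊆ˡ Rest
    F⊆Rest i∈ = ∈-filter⁺ rest? (F⊆S i∈) (top⇒¬bottom (F-top i∈))

    G∩Rest : ∀ {i} → i ∈ˡ G → ¬ (i ∈ˡ Rest)
    G∩Rest i∈G i∈R = proj₂ (∈-filter⁻ rest? {xs = S} i∈R) (G-bottom i∈G)

    G-or-Rest : ∀ {i} → i ∈ˡ S → i ∈ˡ G ⊎ i ∈ˡ Rest
    G-or-Rest {i} i∈ = case bottom? u S i of λ
      { (yes b) → inj₁ (∈-filter⁺ (bottom? u S) i∈ b)
      ; (no ¬b) → inj₂ (∈-filter⁺ rest? i∈ ¬b) }

    size : length S ≡ length F ℕ.+ (length G ℕ.+ length Mid)
    size = ≡.trans
      (ℕP.≤-antisym (Unique-⊆⇒length≤ uniq cover)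
        (Unique-⊆⇒length≤ (UniqueP.++⁺ (UniqueP.filter⁺ (top? u S) uniq)
            (UniqueP.++⁺ (UniqueP.filter⁺ (bottom? u S) uniq) (UniqueP.filter⁺ mid? uniq)
              λ (i∈G , i∈M) → proj₂ (∈-filter⁻ mid? {xs = S} i∈M) (inj₂ (G-bottom i∈G)))
            λ (i∈F , i∈) → case ∈-++⁻ G i∈ of λ
              { (inj₁ i∈G) → top⇒¬bottom (F-top i∈F) (G-bottom i∈G)
              ; (inj₂ i∈M) → proj₂ (∈-filter⁻ mid? {xs = S} i∈M) (inj₁ (F-top i∈F)) })
          λ i∈ → case ∈-++⁻ F i∈ of λ
            { (inj₁ i∈F) → F⊆S i∈F
            ; (inj₂ i∈)  → case ∈-++⁻ G i∈ of λ { (inj₁ i∈G) → G⊆S i∈G ; (inj₂ i∈M) → Mid⊆S i∈M } }))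
      (≡.trans (ListP.length-++ F) (≡.cong (length F ℕ.+_) (ListP.length-++ G)))
      where
      cover : S ⊆ˡ F ++ G ++ Mid
      cover {i} i∈ = case em {Top u S i} of λ
        { (yes t) → ∈-++⁺ˡ (∈-filter⁺ (top? u S) i∈ t)
        ; (no ¬t) → case em {Bottom u S i} of λ
          { (yes b) → ∈-++⁺ʳ F (∈-++⁺ˡ (∈-filter⁺ (bottom? u S) i∈ b))
          ; (no ¬b) → ∈-++⁺ʳ F (∈-++⁺ʳ G (∈-filter⁺ mid? i∈ λ { (inj₁ t) → ¬t t ; (inj₂ b) → ¬b b })) } }

    -- Vanishing on `F` and at `q` costs |F| + 1 constraints and, by rigidity, forces vanishing on
    -- `S`.
    D≤1+F : D ℕ.≤ 1 ℕ.+ length F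
    D≤1+F = ℕP.≮⇒≥ λ short →
      let w , w∈ , sat , s , s∈ , ws≢0 =
            rich (vanish q ∷ map vanish F) (≡.subst (λ k → suc k ℕ.< D) (≡.sym (ListP.length-map vanish F)) short)
      in ws≢0 (rigid w∈ (λ i∈ itop → vanish⁺ {w} F (All.tail sat) (∈-filter⁺ (top? u S) i∈ itop)) (All.head sat) s∈)

    -- `U′` describes the projection along the affine hull of `G`, which defines `F′`. `U″` also
    -- merges the image of `G` with `p`, and is the space for the recursive call.
    U′ U″ : Functionals
    U′ = tied U G q
    U″ = tied U G p

    U″⊆U′ : ∀ {w} → w ∈ member U″ → w ∈ member U′
    U″⊆U′ (w∈ , w-tied) = w∈ , λ i∈ → trans (w-tied i∈) (sym (w-tied q∈G))

    minimalF = minimise U′ F (UniqueP.filter⁺ (top? u S) uniq) (λ _ j∈ → _ , j∈ , ≤-refl)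

    module Face (F′ : List (Fin N)) (F′⊆F : F′ ⊆ˡ F) (uniqF′ : Unique F′) (domF′ : Dominates U′ F′ F)
                (exposedF′ : Exposed U′ F′) where

      -- A functional vanishing on `G` and `F′` is constant on `G`, hence in `U′`, so `F′` makes it
      -- vanish on all of `F`. Rigidity does the rest.
      D≤G+F′ : D ℕ.≤ length G ℕ.+ length F′
      D≤G+F′ = ℕP.≮⇒≥ λ short →
        let w , w∈ , sat , s , s∈ , ws≢0 = rich (map vanish (G ++ F′))
              (≡.subst (ℕ._< D) (≡.sym (≡.trans (ListP.length-map vanish (G ++ F′)) (ListP.length-++ G))) short)
            zeros = vanish⁺ {w} (G ++ F′) sat
            w∈′ : w ∈ member U′
            w∈′ = w∈ , λ i∈ → trans (zeros (∈-++⁺ˡ i∈)) (sym (zeros (∈-++⁺ˡ q∈G)))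
            zerosF = vanish-dominated U′ domF′ {w} w∈′ (λ i∈ → zeros (∈-++⁺ʳ G i∈))
        in ws≢0 (rigid w∈ (λ i∈ itop → zerosF (∈-filter⁺ (top? u S) i∈ itop)) (zeros (∈-++⁺ˡ q∈G)) s∈)

      -- The last component says that `i*` and `i` have the same image along `G`, which makes the
      -- correspondence injective on `F′`.
      Star : Fin N × Fin N → Fin N × Fin N → Set
      Star (i , j) (i* , j*) = j* ≡ j × i* ∈ˡ F × Antipodal U S i* j* × (∀ {v} → v ∈ member U′ → v i* ≈ v i)

      -- A functional `w` of `U′` is constant on `G`, so under `M * u + w` all of `G` stays at the
      -- bottom, while the top shrinks to the points of `F` that project onto the vertex `i`. Then
      -- `oppose` isolates `j` and one of those points.
      star : ∀ {i j} → i ∈ˡ F′ → j ∈ˡ G → ∃ (Star (i , j))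
      star {i} {j} i∈ j∈ = from-vertex (exposedF′ i∈)
        where
        from-vertex : ∃[ w ] w ∈ member U′ × StrictTop w F′ i → ∃ (Star (i , j))
        from-vertex (w , w∈ , strict) = perturbed (lexicographic u w)
          where
          perturbed : ∃[ M ] (∀ {k l} → u k < u l → M * u k + w k < M * u l + w l) → ∃ (Star (i , j))
          perturbed (M , lex) = found (oppose U exposed (combine U u∈ (proj₁ w∈) M) (G⊆S j∈) bottom′ (F⊆S (F′⊆F i∈))
                                  (lex (≤-<-trans (G-bottom j∈ q∈) (<-≤-trans q<p (F-top (F′⊆F i∈) p∈)))))
            where
            bottom′ : Bottom (λ l → M * u l + w l) S j
            bottom′ {l} l∈ = case ≤⇒<⊎≈ (G-bottom j∈ l∈) of λ
              { (inj₁ j<l) → <⇒≤ (lex j<l)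
              ; (inj₂ j≈l) → ≤-reflexive (+-cong (*-congˡ j≈l)
                  (trans (proj₂ w∈ j∈) (sym (proj₂ w∈ (∈-filter⁺ (bottom? u S) l∈ λ k∈ → ≤-respˡ j≈l (G-bottom j∈ k∈)))))) }
            found : ∃[ i* ] i* ∈ˡ S × Top (λ l → M * u l + w l) S i* × Antipodal U S i* j → ∃ (Star (i , j))
            found (i* , i*∈ , top* , antipodal) =
              (i* , j) , ≡.refl , i*∈F , antipodal , same-as-vertex U′ domF′ w∈ strict i*∈F
                (+-cancelˡ-≤ (M * u i*) (≤-respˡ (+-congʳ (*-congˡ (antisym ui≤ (F-top (F′⊆F i∈) i*∈)))) (top* (F⊆S (F′⊆F i∈)))))
              where
              ui≤ : u i ≤ u i*
              ui≤ = ≮⇒≥ λ i*<i → lex i*<i (top* (F⊆S (F′⊆F i∈)))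
              i*∈F : i* ∈ˡ F
              i*∈F = ∈-filter⁺ (top? u S) i*∈ λ l∈ → ≤-trans (F-top (F′⊆F i∈) l∈) ui≤

      star-injective : ∀ {x x′ y} → x ∈ˡ cartesianProduct F′ G → x′ ∈ˡ cartesianProduct F′ G →
        Star x y → Star x′ y → x ≡ x′
      star-injective x∈ x′∈ (≡.refl , _ , _ , same) (≡.refl , _ , _ , same′) =
        ≡.cong (_, _) (separated U′ exposedF′ (proj₁ (∈-cartesianProduct⁻ F′ G x∈)) (proj₁ (∈-cartesianProduct⁻ F′ G x′∈))
          λ v∈ → trans (sym (same v∈)) (same′ v∈))

      stars = transport Star (λ x∈ → let i∈ , j∈ = ∈-cartesianProduct⁻ F′ G x∈ in star i∈ j∈)
                star-injective (UniqueP.cartesianProduct⁺ uniqF′ (UniqueP.filter⁺ (bottom? u S) uniq))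

      -- The candidates for vertices of the image. Points of `F` outside `F′` are already gone,
      -- which is the saving of |F| - |F′|.
      R₀ : List (Fin N)
      R₀ = F′ ++ Mid

      uniqR₀ : Unique R₀
      uniqR₀ = UniqueP.++⁺ uniqF′ (UniqueP.filter⁺ mid? uniq)
        λ (i∈F′ , i∈M) → proj₂ (∈-filter⁻ mid? {xs = S} i∈M) (inj₁ (F-top (F′⊆F i∈F′)))

      domR₀ : Dominates U″ R₀ Rest
      domR₀ {w} w∈ {j} j∈ = case top? u S j of λ
        { (yes t) → let i , i∈ , j≤i = domF′ (U″⊆U′ {w} w∈) (∈-filter⁺ (top? u S) (Rest⊆S j∈) t) in i , ∈-++⁺ˡ i∈ , j≤i
        ; (no ¬t) → j , ∈-++⁺ʳ F′ (∈-filter⁺ mid? (Rest⊆S j∈) λ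
            { (inj₁ t) → ¬t t ; (inj₂ b) → proj₂ (∈-filter⁻ rest? {xs = S} j∈) b }) , ≤-refl }

      minimalRest = minimise U″ Rest uniqR₀ domR₀

      module Projection (S″ : List (Fin N)) (S″⊆R₀ : S″ ⊆ˡ R₀) (uniqS″ : Unique S″) (domS″ : Dominates U″ S″ Rest)
                        (exposedS″ : Exposed U″ S″) where

        S″⊆Rest : S″ ⊆ˡ Rest
        S″⊆Rest i∈ = case ∈-++⁻ F′ (S″⊆R₀ i∈) of λ
          { (inj₁ i∈F′) → F⊆Rest (F′⊆F i∈F′)
          ; (inj₂ i∈M)  → ∈-filter⁺ rest? (Mid⊆S i∈M) (λ b → proj₂ (∈-filter⁻ mid? {xs = S} i∈M) (inj₂ b)) }

        -- Membership in `U″` is enforced by |G| tie constraints. A functional vanishing on `S″`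
        -- would vanish on `Rest`, hence at `p`, hence on `G`.
        rich″ : Rich U″ S″ (D ℕ.∸ length G)
        rich″ cs short =
          let w , w∈ , sat , s , s∈ , ws≢0 = rich (map (λ i → tie i p) G ++ cs) (begin-strict
                length (map (λ i → tie i p) G ++ cs)            ≡⟨ ListP.length-++ (map (λ i → tie i p) G) ⟩
                length (map (λ i → tie i p) G) ℕ.+ length cs    ≡⟨ ≡.cong (ℕ._+ length cs) (ListP.length-map _ G) ⟩
                length G ℕ.+ length cs                          <⟨ add-back (length G) short ⟩
                D                                               ∎)
              w∈″ : w ∈ member U″
              w∈″ = w∈ , λ i∈ → All.lookup (AllP.map⁻ (AllP.++⁻ˡ (map (λ i → tie i p) G) sat)) i∈
          in decidable-stable em λ none →
            let zeros : ∀ {i} → i ∈ˡ S″ → w i ≈ 0#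
                zeros i∈ = decidable-stable em λ wi≢0 →
                  none (w , w∈″ , AllP.++⁻ʳ (map (λ i → tie i p) G) sat , _ , i∈ , wi≢0)
                zerosRest = vanish-dominated U″ domS″ {w} w∈″ zeros
            in ws≢0 (case G-or-Rest s∈ of λ
                 { (inj₁ s∈G) → trans (proj₂ w∈″ s∈G) (zerosRest (F⊆Rest p∈F))
                 ; (inj₂ s∈R) → zerosRest s∈R })
          where
          open ℕP.≤-Reasoning
          add-back : ∀ o {m n} → m ℕ.< n ℕ.∸ o → o ℕ.+ m ℕ.< n
          add-back zero                m<n = m<n
          add-back (suc o) {n = suc n} m<n = ℕ.s≤s (add-back o m<n)

        reach : ∀ {w i} → w ∈ member U″ → StrictTop w S″ i → Top w S i
        reach {w} w∈ strict l∈ = case G-or-Rest l∈ of λ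
          { (inj₁ l∈G) → ≤-respˡ (sym (proj₂ w∈ l∈G)) (below-vertex U″ domS″ w∈ strict (F⊆Rest p∈F))
          ; (inj₂ l∈R) → below-vertex U″ domS″ w∈ strict l∈R }

        -- On `G` the functional has the value `w p`, so `w p < w i` keeps `G` off the top face and
        -- the maximiser supplied by `oppose` lies in `Rest`.
        lift-top : ∀ {w i j} → w ∈ member U″ → i ∈ˡ S″ → j ∈ˡ S″ → w j < w i → StrictTop w S″ i →
          StrictTop (λ l → - w l) S″ j → w p < w i →
          ∃[ i* ] i* ∈ˡ Rest × Antipodal U S i* j × (∀ {v} → v ∈ member U″ → v i* ≈ v i)
        lift-top {w} {i} {j} w∈ i∈ j∈ j<i strict-i strict-j p<i
          = finish (oppose U exposed (proj₁ w∈) (Rest⊆S (S″⊆Rest j∈))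
              (λ l∈ → neg-cancel-≤ (reach (negate U″ w∈) strict-j l∈)) (Rest⊆S (S″⊆Rest i∈)) j<i)
          where
          finish : ∃[ i* ] i* ∈ˡ S × Top w S i* × Antipodal U S i* j →
            ∃[ i* ] i* ∈ˡ Rest × Antipodal U S i* j × (∀ {v} → v ∈ member U″ → v i* ≈ v i)
          finish (i* , i*∈ , top* , antipodal) =
            i* , i*∈R , antipodal , same-as-vertex U″ domS″ w∈ strict-i i*∈R (top* (Rest⊆S (S″⊆Rest i∈)))
            where
            i*∈R : i* ∈ˡ Rest
            i*∈R = case G-or-Rest i*∈ of λ
              { (inj₂ r) → r
              ; (inj₁ g) → contradiction (≤-respʳ (proj₂ w∈ g) (top* (Rest⊆S (S″⊆Rest i∈)))) p<i }

        Lift : Fin N × Fin N → Fin N × Fin N → Set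
        Lift (i , j) (i* , j*) = i* ∈ˡ Rest × j* ∈ˡ Rest × Antipodal U S i* j* ×
          (∀ {v} → v ∈ member U″ → v i* ≈ v i) × (∀ {v} → v ∈ member U″ → v j* ≈ v j)

        -- The merged point cannot be both ends of a pair. An end whose `w`-value differs from that
        -- of `p` is replaced by a nearby maximiser; the other end keeps its representative, which
        -- is outside `G`.
        lift : ∀ {i j} → i ∈ˡ S″ → j ∈ˡ S″ → Antipodal U″ S″ i j → ∃ (Lift (i , j))
        lift {i} {j} i∈ j∈ (w , w∈ , j<i , strict-i , strict-j) with em {w p < w i}
        ... | yes p<i = with-top (lift-top w∈ i∈ j∈ j<i strict-i strict-j p<i)
          where
          with-top : ∃[ i* ] i* ∈ˡ Rest × Antipodal U S i* j × (∀ {v} → v ∈ member U″ → v i* ≈ v i) → ∃ (Lift (i , j))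
          with-top (i* , i*∈ , antipodal , same) = (i* , j) , i*∈ , S″⊆Rest j∈ , antipodal , same , λ _ → refl
        ... | no p≮i = with-bottom (lift-top {λ l → - w l} (negate U″ w∈) j∈ i∈ (neg-mono-< j<i) strict-j
            (λ l∈ l≢i → neg-mono-< (neg-mono-< (strict-i l∈ l≢i))) (neg-mono-< (<-≤-trans j<i (≮⇒≥ p≮i))))
          where
          with-bottom : ∃[ j* ] j* ∈ˡ Rest × Antipodal U S j* i × (∀ {v} → v ∈ member U″ → v j* ≈ v j) → ∃ (Lift (i , j))
          with-bottom (j* , j*∈ , antipodal , same) =
            (i , j*) , S″⊆Rest i∈ , j*∈ , Antipodal-sym {U} {S} antipodal , (λ _ → refl) , same

        conclude : AntipodalPairs U″ S″ (D ℕ.∸ length G) → AntipodalPairs U S D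
        conclude (L″ , uniqL″ , antipodal″ , enough″) = combineLists
          (transport Lift (λ x∈ → let i∈ , j∈ , a = All.lookup antipodal″ x∈ in lift i∈ j∈ a)
            (λ x∈ x′∈ (_ , _ , _ , i≈ , j≈) (_ , _ , _ , i′≈ , j′≈) →
              let i∈ , j∈ , _   = All.lookup antipodal″ x∈
                  i′∈ , j′∈ , _ = All.lookup antipodal″ x′∈
              in ≡.cong₂ _,_ (separated U″ exposedS″ i∈ i′∈ (λ v∈ → trans (sym (i≈ v∈)) (i′≈ v∈)))
                             (separated U″ exposedS″ j∈ j′∈ (λ v∈ → trans (sym (j≈ v∈)) (j′≈ v∈))))
            uniqL″)
          stars
          where
          combineLists :
            ∃[ ys ] Unique ys × length ys ≡ length L″ × All (λ y → ∃[ x ] x ∈ˡ L″ × Lift x y) ys →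
            ∃[ ys ] Unique ys × length ys ≡ length (cartesianProduct F′ G) × All (λ y → ∃[ x ] x ∈ˡ cartesianProduct F′ G × Star x y) ys →
            AntipodalPairs U S D
          combineLists (L₀ , uniq₀ , len₀ , all₀) (L₁ , uniq₁ , len₁ , all₁) =
            -- Lifted pairs have no end in `G`, star pairs only the second, swapped star pairs only
            -- the first; so the three lists are disjoint.
            L₀ ++ L₁ ++ map swap L₁
            , UniqueP.++⁺ uniq₀ (UniqueP.++⁺ uniq₁ (UniqueP.map⁺ (λ { ≡.refl → ≡.refl }) uniq₁) disjoint₁) disjoint₀
            , AllP.++⁺ (All.map (λ (_ , _ , i∈ , j∈ , a , _) → Rest⊆S i∈ , Rest⊆S j∈ , a) all₀)
                (AllP.++⁺ all₁′ (AllP.map⁺ (All.map (λ (i∈ , j∈ , a) → j∈ , i∈ , Antipodal-sym {U} {S} a) all₁′)))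
            , ≡.subst₂ (λ n l → n ℕ.* (2 ℕ.* D) ℕ.≤ l ℕ.+ (n ℕ.* n ℕ.+ n)) (≡.sym size) (≡.sym total-length)
                (Arithmetic.induction-step {D} {length G} {length F} {length F′} {length Mid} {length S″} {length L″}
                  D≤G+F′ D≤1+F (Unique-⊆⇒length≤ uniqF′ F′⊆F)
                  (≡.subst (length S″ ℕ.≤_) (ListP.length-++ F′) (Unique-⊆⇒length≤ uniqS″ S″⊆R₀))
                  (Rich⇒≤length U″ rich″) enough″)
            where
            in-stars : ∀ {i j} → (i , j) ∈ˡ L₁ → i ∈ˡ F × j ∈ˡ G
            in-stars y∈ with (_ , _) , x∈ , ≡.refl , i*∈ , _ ← All.lookup all₁ y∈ = i*∈ , proj₂ (∈-cartesianProduct⁻ F′ G x∈)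
            in-swapped : ∀ {i j} → (i , j) ∈ˡ map swap L₁ → i ∈ˡ G × j ∈ˡ F
            in-swapped y∈ = swap (All.lookup {P = λ (i , j) → j ∈ˡ F × i ∈ˡ G} (AllP.map⁺ (All.tabulate in-stars)) y∈)
            all₁′ : All (λ (i , j) → i ∈ˡ S × j ∈ˡ S × Antipodal U S i j) L₁
            all₁′ = All.tabulate λ y∈ → let i∈ , j∈ = in-stars y∈ ; _ , _ , _ , _ , a , _ = All.lookup all₁ y∈
                                        in F⊆S i∈ , G⊆S j∈ , a
            disjoint₁ : ∀ {y} → ¬ (y ∈ˡ L₁ × y ∈ˡ map swap L₁)
            disjoint₁ (y∈ , y∈′) = G∩Rest (proj₁ (in-swapped y∈′)) (F⊆Rest (proj₁ (in-stars y∈)))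
            disjoint₀ : ∀ {y} → ¬ (y ∈ˡ L₀ × y ∈ˡ L₁ ++ map swap L₁)
            disjoint₀ (y∈ , y∈′) with _ , _ , i∈ , j∈ , _ ← All.lookup all₀ y∈ = case ∈-++⁻ L₁ y∈′ of λ
              { (inj₁ y∈₁) → G∩Rest (proj₂ (in-stars y∈₁)) j∈
              ; (inj₂ y∈₂) → G∩Rest (proj₁ (in-swapped y∈₂)) i∈ }
            product-length : length L₁ ≡ length F′ ℕ.* length G
            product-length = ≡.trans len₁ (length-cartesianProduct F′ G)
            total-length : length (L₀ ++ L₁ ++ map swap L₁) ≡
              length L″ ℕ.+ (length F′ ℕ.* length G ℕ.+ length F′ ℕ.* length G)
            total-length = ≡.trans (ListP.length-++ L₀) (≡.cong₂ ℕ._+_ len₀ (≡.trans (ListP.length-++ L₁)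
              (≡.cong₂ ℕ._+_ product-length (≡.trans (ListP.length-map swap L₁) product-length))))

  antipodal-pairs : ∀ U S D → Unique S → Exposed U S → Rich U S D → AntipodalPairs U S D
  antipodal-pairs U S D = go (<-wellFounded D) U S
    where
    go : ∀ {D} → Acc ℕ._<_ D → ∀ U S → Unique S → Exposed U S → Rich U S D → AntipodalPairs U S D
    go {zero} _ U S _ _ _ = [] , [] , [] , ℕP.≤-trans (ℕP.≤-reflexive (ℕP.*-zeroʳ (length S))) ℕ.z≤n
    -- For D = 1 the bound reads 2n ≤ n² + n, which the empty list satisfies.
    go {suc zero} _ U S _ _ _ = [] , [] , [] , small (length S)
      where
      small : ∀ n → n ℕ.* 2 ℕ.≤ n ℕ.* n ℕ.+ n
      small n = ℕP.≤-trans (ℕP.≤-reflexive (≡.trans (ℕP.*-comm n 2) (≡.cong (n ℕ.+_) (ℕP.+-identityʳ n))))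
        (ℕP.+-monoˡ-≤ n (square n))
        where
        square : ∀ n → n ℕ.≤ n ℕ.* n
        square zero    = ℕ.z≤n
        square (suc n) = ℕP.m≤m+n (suc n) _
    go {D@(suc (suc _))} (acc rec) U S uniq exposed rich =
      -- The recursion descends because `G` contains `q`.
      conclude (go (rec (smaller (∈-length q∈G))) U″ S″ uniqS″ exposedS″ rich″)
      where
      open Merge U S D uniq exposed rich (facet U uniq rich)
      open Face (proj₁ minimalF) (proj₁ (proj₂ minimalF)) (proj₁ (proj₂ (proj₂ minimalF)))
        (proj₁ (proj₂ (proj₂ (proj₂ minimalF)))) (proj₂ (proj₂ (proj₂ (proj₂ minimalF))))
      smaller : ∀ {g} → 0 ℕ.< g → D ℕ.∸ g ℕ.< D
      smaller {suc g} _ = ℕ.s≤s (ℕP.m∸n≤m _ g)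
      S″ = proj₁ minimalRest
      uniqS″ = proj₁ (proj₂ (proj₂ minimalRest))
      exposedS″ = proj₂ (proj₂ (proj₂ (proj₂ minimalRest)))
      open Projection S″ (proj₁ (proj₂ minimalRest)) uniqS″ (proj₁ (proj₂ (proj₂ (proj₂ minimalRest)))) exposedS″

-- Sums, scalar products and homogeneous systems

module LinearAlgebra (em : ExcludedMiddle 0ℓ) (ℝ : Reals) where
  open Reals ℝ hiding (zero)
  open OrderedField em ℝ
  open Geometry ℝ
  open IntegerSolver commutativeRing
  open import Algebra.Definitions.RawMonoid +-rawMonoid using (sum)
  open import Algebra.Properties.CommutativeMonoid.Sum +-commutativeMonoid using (sum-cong-≋; ∑-distrib-+; ∑-comm; sum-replicate-zero)
  open import Algebra.Properties.Semiring.Sum semiring using (*-distribˡ-sum; *-distribʳ-sum)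
  open import Algebra.Properties.Ring ring using (-‿distribˡ-*)
  open import Relation.Binary.Reasoning.Setoid setoid

  sum-zero : ∀ {n} {f : Vector Carrier n} → (∀ i → f i ≈ 0#) → sum f ≈ 0#
  sum-zero {n} zeros = trans (sum-cong-≋ zeros) (sum-replicate-zero n)

  sum-mono-≤ : ∀ {n} {f g : Vector Carrier n} → (∀ i → f i ≤ g i) → sum f ≤ sum g
  sum-mono-≤ {zero}  f≤g = ≤-refl
  sum-mono-≤ {suc n} f≤g = +-mono-≤ (f≤g zero) (sum-mono-≤ (λ i → f≤g (suc i)))

  unit : ∀ {n} → Fin n → Vector Carrier n
  unit zero    zero    = 1#
  unit zero    (suc _) = 0#
  unit (suc _) zero    = 0#
  unit (suc a) (suc b) = unit a b

  unit-nonNeg : ∀ {n} (a b : Fin n) → 0# ≤ unit a b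
  unit-nonNeg zero    zero    = <⇒≤ 0<1
  unit-nonNeg zero    (suc b) = ≤-refl
  unit-nonNeg (suc a) zero    = ≤-refl
  unit-nonNeg (suc a) (suc b) = unit-nonNeg a b

  unit-diagonal : ∀ {n} (a : Fin n) → unit a a ≈ 1#
  unit-diagonal zero    = refl
  unit-diagonal (suc a) = unit-diagonal a

  unit-off-diagonal : ∀ {n} {a b : Fin n} → a ≢ b → unit a b ≈ 0#
  unit-off-diagonal {a = zero}  {zero}  a≢b = contradiction ≡.refl a≢b
  unit-off-diagonal {a = zero}  {suc b} a≢b = refl
  unit-off-diagonal {a = suc a} {zero}  a≢b = refl
  unit-off-diagonal {a = suc a} {suc b} a≢b = unit-off-diagonal (λ eq → a≢b (≡.cong suc eq))

  dot-cong : ∀ {d} {u v p q : Point d} → u ≋ v → p ≋ q → dot u p ≈ dot v q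
  dot-cong u≋v p≋q = sum-cong-≋ λ a → *-cong (u≋v a) (p≋q a)

  dot-comm : ∀ {d} (u p : Point d) → dot u p ≈ dot p u
  dot-comm u p = sum-cong-≋ λ a → *-comm (u a) (p a)

  dot-zeroˡ : ∀ {d} {u p : Point d} → (∀ a → u a ≈ 0#) → dot u p ≈ 0#
  dot-zeroˡ zeros = sum-zero λ a → trans (*-congʳ (zeros a)) (zeroˡ _)

  dot-combine : ∀ {d} M (u v p : Point d) → dot (λ a → M * u a + v a) p ≈ M * dot u p + dot v p
  dot-combine M u v p = begin
    dot (λ a → M * u a + v a) p                        ≈⟨ sum-cong-≋ (λ a → trans (distribʳ (p a) (M * u a) (v a)) (+-congʳ (*-assoc M (u a) (p a)))) ⟩
    sum (λ a → M * (u a * p a) + v a * p a)            ≈⟨ ∑-distrib-+ (λ a → M * (u a * p a)) (λ a → v a * p a) ⟩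
    sum (λ a → M * (u a * p a)) + dot v p              ≈⟨ +-congʳ (*-distribˡ-sum M (λ a → u a * p a)) ⟨
    M * dot u p + dot v p                              ∎

  dot-neg : ∀ {d} (u p : Point d) → dot (λ a → - u a) p ≈ - dot u p
  dot-neg u p = begin
    dot (λ a → - u a) p                   ≈⟨ sum-cong-≋ (λ a → trans (sym (-‿distribˡ-* (u a) (p a))) (minus-one (u a * p a))) ⟩
    sum (λ a → - 1# * (u a * p a))        ≈⟨ *-distribˡ-sum (- 1#) (λ a → u a * p a) ⟨
    - 1# * dot u p                        ≈⟨ minus-one (dot u p) ⟨
    - dot u p                             ∎
    where
    minus-one : ∀ x → - x ≈ - 1# * x
    minus-one x = trans (-‿cong (sym (*-identityˡ x))) (-‿distribˡ-* 1# x)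

  dot-unitʳ : ∀ {d} (u : Point d) a → dot u (unit a) ≈ u a
  dot-unitʳ u zero = trans (+-cong (*-identityʳ _) (sum-zero (λ a → zeroʳ (u (suc a))))) (+-identityʳ _)
  dot-unitʳ u (suc a) = trans (+-cong (zeroʳ _) (dot-unitʳ (λ b → u (suc b)) a)) (+-identityˡ _)

  dot-combination : ∀ {n d} c (w : Vector Carrier n) (x : Vector (Point d) n) →
    dot c (combination w x) ≈ sum (λ i → w i * dot c (x i))
  dot-combination c w x = begin
    dot c (combination w x)                          ≈⟨ sum-cong-≋ (λ a → *-distribˡ-sum (c a) (λ i → w i * x i a)) ⟩
    sum (λ a → sum (λ i → c a * (w i * x i a)))      ≈⟨ ∑-comm (λ a i → c a * (w i * x i a)) ⟩
    sum (λ i → sum (λ a → c a * (w i * x i a)))      ≈⟨ sum-cong-≋ (λ i → trans (sum-cong-≋ (λ a → shuffle (c a) (w i) (x i a))) (sym (*-distribˡ-sum (w i) (λ a → c a * x i a)))) ⟩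
    sum (λ i → w i * dot c (x i))                    ∎
    where
    shuffle : ∀ c w x → c * (w * x) ≈ w * (c * x)
    shuffle = solve 3 (λ c w x → c :* (w :* x) := w :* (c :* x)) refl

  weighted-constant : ∀ {n} (w : Vector Carrier n) m → sum w ≈ 1# → sum (λ i → w i * m) ≈ m
  weighted-constant w m w≈1 = trans (sym (*-distribʳ-sum m w)) (trans (*-congʳ w≈1) (*-identityˡ m))

  sum-unit : ∀ {n} (a : Fin n) → sum (unit a) ≈ 1#
  sum-unit a = trans (sum-cong-≋ (λ b → sym (*-identityˡ (unit a b)))) (dot-unitʳ (λ _ → 1#) a)

  combination-unit : ∀ {n d} (x : Vector (Point d) n) i → combination (unit i) x ≋ x i
  combination-unit x i a = trans (dot-comm (unit i) (λ l → x l a)) (dot-unitʳ (λ l → x l a) i)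

  point∈conv : ∀ {n d} (x : Vector (Point d) n) i → x i ∈ conv x
  point∈conv x i = unit i , unit-nonNeg i , sum-unit i , λ a → sym (combination-unit x i a)

  dot-conv : ∀ {n d} c w (x : Vector (Point d) n) {p} → p ≋ combination w x → dot c p ≈ sum (λ i → w i * dot c (x i))
  dot-conv c w x p≋ = trans (dot-cong (λ _ → refl) p≋) (dot-combination c w x)

  conv-≤ : ∀ {n d} c {x : Vector (Point d) n} {m} → (∀ i → dot c (x i) ≤ m) → ∀ {p} → p ∈ conv x → dot c p ≤ m
  conv-≤ c {x} {m} below (w , w≥0 , w≈1 , p≋) = ≤-respˡ (sym (dot-conv c w x p≋))
    (≤-respʳ (weighted-constant w m w≈1) (sum-mono-≤ λ i → *-monoʳ-≤ (w≥0 i) (below i)))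

  conv-≥ : ∀ {n d} c {x : Vector (Point d) n} {m} → (∀ i → m ≤ dot c (x i)) → ∀ {p} → p ∈ conv x → m ≤ dot c p
  conv-≥ c {x} {m} above (w , w≥0 , w≈1 , p≋) = ≤-respʳ (sym (dot-conv c w x p≋))
    (≤-respˡ (weighted-constant w m w≈1) (sum-mono-≤ λ i → *-monoʳ-≤ (w≥0 i) (above i)))

  -- A row operation in cross-multiplied form, which avoids dividing by the pivot.
  eliminate : ∀ {n} → Carrier → Vector Carrier n → Carrier → Vector Carrier n → Vector Carrier n
  eliminate s₀ s t₀ t a = t₀ * s a + (- s₀) * t a

  -- Gaussian elimination: a row with nonzero leading coefficient removes the first unknown from all
  -- the others. Without such a row the first unit vector is a solution.
  homogeneous : ∀ {m n} → m ℕ.< n → (A : Fin m → Vector Carrier n) →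
    ∃[ c ] (∃[ a ] c a ≢0) × (∀ t → dot (A t) c ≈ 0#)
  homogeneous {zero}  {suc n} _ A = (λ _ → 1#) , (zero , λ 1≈0 → 0≉1 (sym 1≈0)) , λ ()
  homogeneous {suc m} {suc n} (ℕ.s≤s m<n) A with em {∃[ t ] A t zero ≢0}
  ... | no none = unit zero , (zero , λ 1≈0 → 0≉1 (sym 1≈0)) ,
    λ t → trans (dot-unitʳ (A t) zero) (decidable-stable em (λ ≢0 → none (t , ≢0)))
  ... | yes (t , pivot≢0) = back (homogeneous m<n (λ s → eliminate (A (punchIn t s) zero) (tail (A (punchIn t s))) pivot (tail (A t))))
    where
    tail : Vector Carrier (suc n) → Vector Carrier n
    tail v a = v (suc a)
    pivot : Carrier
    pivot = A t zero
    back : ∃[ c ] (∃[ a ] c a ≢0) × (∀ s → dot (eliminate (A (punchIn t s) zero) (tail (A (punchIn t s))) pivot (tail (A t))) c ≈ 0#) →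
      ∃[ c ] (∃[ a ] c a ≢0) × (∀ s → dot (A s) c ≈ 0#)
    back (c , (a , ca≢0) , zeros) = c′ , (suc a , λ eq → ca≢0 (integral pivot≢0 eq)) , zeros′
      where
      c′ : Vector Carrier (suc n)
      -- Scaling the smaller solution by the pivot lets row `t` be solved for the first unknown
      -- without division.
      c′ zero    = - dot (tail (A t)) c
      c′ (suc a) = pivot * c a
      expand : ∀ s → dot (A s) c′ ≈ pivot * dot (tail (A s)) c + (- A s zero) * dot (tail (A t)) c
      expand s = begin
        A s zero * - dot (tail (A t)) c + sum (λ a → A s (suc a) * (pivot * c a))
          ≈⟨ +-congˡ (trans (sum-cong-≋ (λ a → shuffle (A s (suc a)) pivot (c a))) (sym (*-distribˡ-sum pivot (λ a → A s (suc a) * c a)))) ⟩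
        A s zero * - dot (tail (A t)) c + pivot * dot (tail (A s)) c
          ≈⟨ rearrange (A s zero) (dot (tail (A t)) c) (pivot * dot (tail (A s)) c) ⟩
        pivot * dot (tail (A s)) c + (- A s zero) * dot (tail (A t)) c ∎
        where
        shuffle : ∀ c w x → c * (w * x) ≈ w * (c * x)
        shuffle = solve 3 (λ c w x → c :* (w :* x) := w :* (c :* x)) refl
        rearrange : ∀ a x y → a * - x + y ≈ y + (- a) * x
        rearrange = solve 3 (λ a x y → a :* (:- x) :+ y := y :+ (:- a) :* x) refl
      zeros′ : ∀ s → dot (A s) c′ ≈ 0#
      zeros′ s with t ≟ s
      ... | yes ≡.refl = trans (expand t) (cancel pivot (dot (tail (A t)) c))
        where
        cancel : ∀ a x → a * x + (- a) * x ≈ 0#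
        cancel a x = trans (solve 2 (λ a x → a :* x :+ (:- a) :* x := a :* x :- a :* x) refl a x) (-‿inverseʳ (a * x))
      ... | no t≢s = ≡.subst (λ s → dot (A s) c′ ≈ 0#) (FinP.punchIn-punchOut t≢s) (row (punchOut t≢s))
        where
        row : ∀ r → dot (A (punchIn t r)) c′ ≈ 0#
        row r = begin
          dot (A (punchIn t r)) c′
            ≈⟨ expand (punchIn t r) ⟩
          pivot * dot (tail (A (punchIn t r))) c + (- A (punchIn t r) zero) * dot (tail (A t)) c
            ≈⟨ +-congˡ (trans (*-distribˡ-sum (- A (punchIn t r) zero) (λ a → A t (suc a) * c a))
                 (sum-cong-≋ (λ a → sym (*-assoc (- A (punchIn t r) zero) (A t (suc a)) (c a))))) ⟩
          pivot * dot (tail (A (punchIn t r))) c + dot (λ a → (- A (punchIn t r) zero) * A t (suc a)) c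
            ≈⟨ dot-combine pivot (tail (A (punchIn t r))) (λ a → (- A (punchIn t r) zero) * A t (suc a)) c ⟨
          dot (eliminate (A (punchIn t r) zero) (tail (A (punchIn t r))) pivot (tail (A t))) c
            ≈⟨ zeros r ⟩
          0# ∎

-- From functionals back to strictly antipodal pairs

module LowerBound (em : ExcludedMiddle 0ℓ) (ℝ : Reals) {n d} (x : Vector (Geometry.Point ℝ d) n)
                  (x∈𝒞 : Geometry.𝒞ˢ ℝ d n x) where
  open Reals ℝ hiding (zero)
  open OrderedField em ℝ
  open Geometry ℝ
  open Counting em
  open Configuration em ℝ n
  open PairCounting em ℝ n
  open LinearAlgebra em ℝ
  open IntegerSolver commutativeRing
  open import Algebra.Definitions.RawMonoid +-rawMonoid using (sum)
  open import Algebra.Properties.CommutativeMonoid.Sum +-commutativeMonoid using (sum-cong-≋)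
  open import Algebra.Properties.Ring ring using (-0#≈0#)
  open import Relation.Binary.Reasoning.Setoid setoid
  open 𝒞ˢ x∈𝒞
  open Hyperplane

  affine : Functionals
  affine = record
    { member  = λ w → ∃[ c ] ∃[ e ] ∀ i → w i ≈ dot c (x i) + e
    ; combine = λ (c , e , eq) (c′ , e′ , eq′) M → (λ a → M * c a + c′ a) , M * e + e′ , λ i →
        trans (+-cong (*-congˡ (eq i)) (eq′ i))
          (trans (rearrange M (dot c (x i)) e (dot c′ (x i)) e′) (+-congʳ (sym (dot-combine M c c′ (x i)))))
    ; negate  = λ (c , e , eq) → (λ a → - c a) , - e , λ i →
        trans (-‿cong (eq i)) (trans (negated (dot c (x i)) e) (+-congʳ (sym (dot-neg c (x i)))))
    ; shift   = λ (c , e , eq) e′ → c , e + e′ , λ i → trans (+-congʳ (eq i)) (+-assoc _ _ _)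
    }
    where
    rearrange : ∀ M p e p′ e′ → M * (p + e) + (p′ + e′) ≈ (M * p + p′) + (M * e + e′)
    rearrange = solve 5 (λ M p e p′ e′ → M :* (p :+ e) :+ (p′ :+ e′) := (M :* p :+ p′) :+ (M :* e :+ e′)) refl
    negated : ∀ p e → - (p + e) ≈ - p + - e
    negated = solve 2 (λ p e → :- (p :+ e) := :- p :+ :- e) refl

  linear∈affine : ∀ c → (λ i → dot c (x i)) ∈ member affine
  linear∈affine c = c , 0# , λ i → sym (+-identityʳ _)

  exposed : Exposed affine (allFin n)
  exposed {i} _ with H , (_ , side) , face ← proj₁ strictlyConvexPosition (i , λ _ → refl) = top side
    where
    on-H : dot (normal H) (x i) ≈ offset H
    on-H = proj₂ (proj₂ face (λ _ → refl))
    only : ∀ {l} → l ≢ i → ¬ (dot (normal H) (x l) ≈ offset H)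
    only {l} l≢i eq = l≢i (distinct (proj₁ face (point∈conv x l , eq)))
    top : _ → ∃[ w ] w ∈ member affine × StrictTop w (allFin n) i
    top (inj₁ below) = _ , linear∈affine (normal H) , λ {l} _ l≢i →
      <-≤-trans (≤∧≉⇒< (below (point∈conv x l)) (only l≢i)) (≤-reflexive (sym on-H))
    top (inj₂ above) = _ , negate affine (linear∈affine (normal H)) , λ {l} _ l≢i →
      neg-mono-< (≤-<-trans (≤-reflexive on-H) (≤∧≉⇒< (above (point∈conv x l)) (λ eq → only l≢i (sym eq))))

  -- Every point of space is an affine combination of the given ones, so the functional vanishes
  -- everywhere. The origin then yields `e` and the unit vectors yield the coefficients.
  spanning : ∀ c e → (∀ i → dot c (x i) + e ≈ 0#) → e ≈ 0# × (∀ a → c a ≈ 0#)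
  spanning c e zeros = e≈0 , λ a → trans (sym (dot-unitʳ c a)) (trans (everywhere (unit a)) (trans (-‿cong e≈0) -0#≈0#))
    where
    everywhere : ∀ p → dot c p ≈ - e
    everywhere p with w , w≈1 , p≋ ← affinelySpanning p = begin
      dot c p                          ≈⟨ dot-conv c w x p≋ ⟩
      sum (λ i → w i * dot c (x i))    ≈⟨ sum-cong-≋ (λ i → *-congˡ (trans (isolate (dot c (x i)) e) (trans (+-congʳ (zeros i)) (+-identityˡ _)))) ⟩
      sum (λ i → w i * - e)            ≈⟨ weighted-constant w (- e) w≈1 ⟩
      - e                              ∎
      where
      isolate : ∀ p e → p ≈ (p + e) + - e
      isolate = solve 2 (λ p e → p := (p :+ e) :+ :- e) refl
    e≈0 : e ≈ 0#
    e≈0 = begin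
      e              ≈⟨ solve 1 (λ e → e := :- :- e) refl e ⟩
      - - e          ≈⟨ -‿cong (trans (sym (everywhere (λ _ → 0#))) (trans (dot-comm c (λ _ → 0#)) (dot-zeroˡ {u = λ _ → 0#} {c} (λ _ → refl)))) ⟩
      - 0#           ≈⟨ -0#≈0# ⟩
      0#             ∎

  -- The unknowns are the coefficients of an affine functional, constant term first.
  equation : Constraint → Vector Carrier (suc d)
  equation (vanish i) zero    = 1#
  equation (vanish i) (suc a) = x i a
  equation (tie i j)  zero    = 0#
  equation (tie i j)  (suc a) = x i a + - x j a

  -- Fewer than d + 1 equations in d + 1 coefficients have a nonzero solution, and `spanning` keeps
  -- it from vanishing on every point.
  rich : Rich affine (allFin n) (suc d)
  rich cs short = solution (homogeneous short (λ t → equation (List.lookup cs t)))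
    where
    solution : ∃[ c ] (∃[ a ] c a ≢0) × (∀ t → dot (equation (List.lookup cs t)) c ≈ 0#) →
      ∃[ w ] w ∈ member affine × All (Satisfies w) cs × ∃[ s ] s ∈ˡ allFin n × w s ≢0
    solution (c , (a , ca≢0) , zeros) =
      w , (linear , c zero , λ _ → refl) ,
      All.tabulate (λ {k} k∈ → satisfied k (≡.subst (λ k → dot (equation k) c ≈ 0#) (≡.sym (AnyP.lookup-index k∈)) (zeros (Any.index k∈)))) ,
      nontrivial
      where
      linear : Point d
      linear b = c (suc b)
      w : Functional
      w i = dot linear (x i) + c zero
      satisfied : ∀ k → dot (equation k) c ≈ 0# → Satisfies w k
      satisfied (vanish i) eq = begin
        dot linear (x i) + c zero        ≈⟨ +-cong (dot-comm linear (x i)) (sym (*-identityˡ _)) ⟩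
        dot (x i) linear + 1# * c zero   ≈⟨ +-comm _ _ ⟩
        1# * c zero + dot (x i) linear   ≈⟨ eq ⟩
        0#                               ∎
      satisfied (tie i j) eq = begin
        dot linear (x i) + c zero                                  ≈⟨ split (dot linear (x i)) (dot linear (x j)) (c zero) ⟩
        (dot linear (x i) + - dot linear (x j)) + (dot linear (x j) + c zero)  ≈⟨ +-congʳ difference ⟩
        0# + (dot linear (x j) + c zero)                           ≈⟨ +-identityˡ _ ⟩
        dot linear (x j) + c zero                                  ∎
        where
        split : ∀ p q e → p + e ≈ (p + - q) + (q + e)
        split = solve 3 (λ p q e → p :+ e := (p :+ :- q) :+ (q :+ e)) refl
        difference : dot linear (x i) + - dot linear (x j) ≈ 0#
        difference = begin
          dot linear (x i) + - dot linear (x j)                    ≈⟨ +-cong (trans (dot-comm linear (x i)) (sym (*-identityˡ _))) (trans (-‿cong (dot-comm linear (x j))) (sym (dot-neg (x j) linear))) ⟩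
          1# * dot (x i) linear + dot (λ a → - x j a) linear       ≈⟨ dot-combine 1# (x i) (λ a → - x j a) linear ⟨
          dot (λ a → 1# * x i a + - x j a) linear                  ≈⟨ sum-cong-≋ (λ a → *-congʳ (+-congʳ (*-identityˡ (x i a)))) ⟩
          dot (λ a → x i a + - x j a) linear                       ≈⟨ trans (+-congʳ (zeroˡ _)) (+-identityˡ _) ⟨
          0# * c zero + dot (λ a → x i a + - x j a) linear         ≈⟨ eq ⟩
          0#                                                       ∎
      nontrivial : ∃[ s ] s ∈ˡ allFin n × w s ≢0
      nontrivial = decidable-stable em λ none →
        let e≈0 , linear≈0 = spanning linear (c zero) (λ i → decidable-stable em λ wi≢0 → none (i , ∈-allFin i , wi≢0))
        in ca≢0 (vanishing e≈0 linear≈0 a)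
        where
        vanishing : c zero ≈ 0# → (∀ b → c (suc b) ≈ 0#) → ∀ a → c a ≈ 0#
        vanishing e≈0 _        zero    = e≈0
        vanishing _   linear≈0 (suc b) = linear≈0 b

  -- Both hyperplanes are level sets of the linear part of `w`, at its greatest and least value on
  -- the points, so they are parallel with factor 1.
  Antipodal⇒StrictlyAntipodal : ∀ {i j} → Antipodal affine (allFin n) i j → StrictlyAntipodal x i j
  Antipodal⇒StrictlyAntipodal {i} {j} (w , (c , e , eq) , wj<wi , top , bottom) =
    (λ xi≋xj → <⇒≉ j<i (sym (dot-cong (λ _ → refl) xi≋xj))) ,
    hyperplane i , hyperplane j ,
    (λ same → <⇒≉ j<i (sym (proj₁ same {x i} refl))) ,
    (1# , λ a → sym (*-identityˡ _)) ,
    ((x i , point∈conv x i , refl) , inj₁ (conv-≤ c (λ l → ≮⇒≥ (above l)))) ,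
    ((x j , point∈conv x j , refl) , inj₂ (conv-≥ c (λ l → ≮⇒≥ (below l)))) ,
    ((λ {p} → only-i {p}) , λ p≋ → (i , p≋) , dot-cong (λ _ → refl) p≋) ,
    ((λ {p} → only-j {p}) , λ p≋ → (j , p≋) , dot-cong (λ _ → refl) p≋)
    where
    f : Functional
    f l = dot c (x l)
    forget : ∀ {k l} → w k < w l → f k < f l
    forget {k} {l} wk<wl le = wk<wl (≤-respˡ (sym (eq l)) (≤-respʳ (sym (eq k)) (+-monoˡ-≤ e le)))
    j<i : f j < f i
    j<i = forget wj<wi
    top′ : ∀ {l} → l ≢ i → f l < f i
    top′ l≢i = forget (top (∈-allFin _) l≢i)
    bottom′ : ∀ {l} → l ≢ j → f j < f l
    bottom′ l≢j = forget λ le → bottom (∈-allFin _) l≢j (neg-mono-≤ le)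
    above : ∀ l → ¬ (f i < f l)
    above l i<l with l ≟ i
    ... | yes ≡.refl = <-irrefl refl i<l
    ... | no  l≢i    = i<l (<⇒≤ (top′ l≢i))
    below : ∀ l → ¬ (f l < f j)
    below l l<j with l ≟ j
    ... | yes ≡.refl = <-irrefl refl l<j
    ... | no  l≢j    = l<j (<⇒≤ (bottom′ l≢j))
    hyperplane : Fin n → Hyperplane d
    hyperplane l = record
      { normal = c ; offset = f l
      ; nonzero = λ c≈0 → <⇒≉ j<i (trans (dot-zeroˡ c≈0) (sym (dot-zeroˡ c≈0))) }
    only-i : ∀ {p} → p ∈ (⟦ x ⟧ ∩ points (hyperplane i)) → p ≋ x i
    only-i ((l , p≋) , on) with l ≟ i
    ... | yes ≡.refl = p≋
    ... | no  l≢i    = contradiction (trans (sym (dot-cong (λ _ → refl) p≋)) on) (<⇒≉ (top′ l≢i))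
    only-j : ∀ {p} → p ∈ (⟦ x ⟧ ∩ points (hyperplane j)) → p ≋ x j
    only-j ((l , p≋) , on) with l ≟ j
    ... | yes ≡.refl = p≋
    ... | no  l≢j    = contradiction (trans (sym on) (dot-cong (λ _ → refl) p≋)) (<⇒≉ (bottom′ l≢j))

  -- The induction counts ordered pairs while `sa` lists each pair once, hence `sa x` appears twice.
  lower-bound : n ℕ.* (2 ℕ.* suc d) ℕ.≤ (sa x ℕ.+ sa x) ℕ.+ (n ℕ.* n ℕ.+ n)
  lower-bound = count (antipodal-pairs affine (allFin n) (suc d) (UniqueP.allFin⁺ n) exposed rich)
    where
    open Lists
    pairs : List (Fin n × Fin n)
    pairs = filter (λ (i , j) → em {i Fin.< j × StrictlyAntipodal x i j}) (cartesianProduct (allFin n) (allFin n))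
    pair : ∀ {i j} → i Fin.< j → Antipodal affine (allFin n) i j → (i , j) ∈ˡ pairs
    pair {i} {j} i<j a = ∈-filter⁺ (λ (i , j) → em {i Fin.< j × StrictlyAntipodal x i j})
      (∈-cartesianProduct⁺ (∈-allFin i) (∈-allFin j)) (i<j , Antipodal⇒StrictlyAntipodal a)
    oriented : ∀ {i j} → Antipodal affine (allFin n) i j → (i , j) ∈ˡ pairs ++ map swap pairs
    oriented {i} {j} a@(w , _ , wj<wi , _) with FinP.<-cmp i j
    ... | tri< i<j _ _    = ∈-++⁺ˡ (pair i<j a)
    ... | tri≈ _ ≡.refl _ = contradiction wj<wi (<-irrefl refl)
    ... | tri> _ _ j<i    = ∈-++⁺ʳ pairs (∈-map⁺ swap (pair j<i (Antipodal-sym {affine} {allFin n} a)))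
    count : AntipodalPairs affine (allFin n) (suc d) → n ℕ.* (2 ℕ.* suc d) ℕ.≤ (sa x ℕ.+ sa x) ℕ.+ (n ℕ.* n ℕ.+ n)
    count (L , uniq , all , enough) =
      ≡.subst (λ k → k ℕ.* (2 ℕ.* suc d) ℕ.≤ (sa x ℕ.+ sa x) ℕ.+ (k ℕ.* k ℕ.+ k)) (ListP.length-tabulate {n = n} (λ i → i))
        (ℕP.≤-trans enough (ℕP.+-monoˡ-≤ _ (ℕP.≤-trans
          (Unique-⊆⇒length≤ uniq λ ij∈ → let _ , _ , a = All.lookup all ij∈ in oriented a)
          (ℕP.≤-reflexive (≡.trans (ListP.length-++ pairs) (≡.cong (length pairs ℕ.+_) (ListP.length-map swap pairs)))))))

-- Criteria for strictly convex position

module ConvexPosition (em : ExcludedMiddle 0ℓ) (ℝ : Reals) where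
  open Reals ℝ hiding (zero)
  open OrderedField em ℝ
  open Geometry ℝ
  open Hyperplane using (points)
  open LinearAlgebra em ℝ
  open IntegerSolver commutativeRing
  open import Algebra.Definitions.RawMonoid +-rawMonoid using (sum)
  open import Algebra.Properties.CommutativeMonoid.Sum +-commutativeMonoid using (sum-cong-≋; ∑-distrib-+)
  open import Algebra.Properties.Ring ring using (-0#≈0#)
  open import Relation.Binary.Reasoning.Setoid setoid

  sum-nonNeg : ∀ {n} {f : Vector Carrier n} → (∀ i → 0# ≤ f i) → 0# ≤ sum f
  sum-nonNeg {zero}  f≥0 = ≤-refl
  sum-nonNeg {suc n} f≥0 = ≤-respˡ (+-identityˡ 0#) (+-mono-≤ (f≥0 zero) (sum-nonNeg (λ i → f≥0 (suc i))))

  sum-nonNeg≈0 : ∀ {n} {f : Vector Carrier n} → (∀ i → 0# ≤ f i) → sum f ≈ 0# → ∀ i → f i ≈ 0#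
  sum-nonNeg≈0 {suc n} {f} f≥0 total≈0 = λ { zero → head≈0 ; (suc i) → sum-nonNeg≈0 (λ i → f≥0 (suc i)) tail≈0 i }
    where
    head≈0 : f zero ≈ 0#
    head≈0 = antisym (≤-respˡ (+-identityʳ _) (≤-respʳ total≈0 (+-monoʳ-≤ (f zero) (sum-nonNeg (λ i → f≥0 (suc i)))))) (f≥0 zero)
    tail≈0 : sum (λ i → f (suc i)) ≈ 0#
    tail≈0 = trans (sym (trans (+-congʳ head≈0) (+-identityˡ _))) total≈0

  -- Complementary slackness: the products are nonnegative and sum to m - m, so an average that
  -- attains the bound gives no weight to points below it.
  slack : ∀ {n} {w f : Vector Carrier n} {m} → (∀ i → 0# ≤ w i) → sum w ≈ 1# → (∀ i → f i ≤ m) →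
    sum (λ i → w i * f i) ≈ m → ∀ i → w i * (m - f i) ≈ 0#
  slack {w = w} {f} {m} w≥0 w≈1 f≤m average = sum-nonNeg≈0 (λ i → *-nonNeg (w≥0 i) (≤⇒0≤- (f≤m i))) (begin
    sum (λ i → w i * (m - f i))                            ≈⟨ sum-cong-≋ (λ i → distribˡ (w i) m (- f i)) ⟩
    sum (λ i → w i * m + w i * - f i)                      ≈⟨ ∑-distrib-+ (λ i → w i * m) (λ i → w i * - f i) ⟩
    sum (λ i → w i * m) + sum (λ i → w i * - f i)          ≈⟨ +-cong (weighted-constant w m w≈1) (trans (sum-cong-≋ (λ i → *-comm (w i) (- f i))) (dot-neg f w)) ⟩
    m - sum (λ i → f i * w i)                              ≈⟨ +-congˡ (-‿cong (trans (dot-comm f w) average)) ⟩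
    m - m                                                  ≈⟨ -‿inverseʳ m ⟩
    0#                                                     ∎)

  -- Write the vertex as a convex combination. By `slack` a point with nonzero weight lies on its
  -- supporting hyperplane, and so is the vertex.
  vert⊆ : ∀ {n d} (x : Vector (Point d) n) → vert (conv x) ⊆ ⟦ x ⟧
  vert⊆ {n} x {v} (H , (_ , side) , face) = on-face (proj₂ face {v} (λ _ → refl))
    where
    open Hyperplane H using (normal; offset)
    on-face : v ∈ conv x ∩ points H → v ∈ ⟦ x ⟧
    on-face ((w , w≥0 , w≈1 , v≋) , on-H) = vertex (decidable-stable em λ none →
        0≉1 (trans (sym (sum-zero (λ i → decidable-stable em λ wi≢0 → none (i , wi≢0)))) w≈1))
      where
      average : sum (λ i → w i * dot normal (x i)) ≈ offset
      average = trans (sym (dot-conv normal w x v≋)) on-H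
      tight : _ → ∀ i → w i ≢0 → dot normal (x i) ≈ offset
      tight (inj₁ below) i wi≢0 = begin
        dot normal (x i)                              ≈⟨ solve 2 (λ f m → f := m :- (m :- f)) refl (dot normal (x i)) offset ⟩
        offset - (offset - dot normal (x i))          ≈⟨ +-congˡ (-‿cong (integral wi≢0 (slack w≥0 w≈1 (λ i → below (point∈conv x i)) average i))) ⟩
        offset - 0#                                   ≈⟨ trans (+-congˡ -0#≈0#) (+-identityʳ _) ⟩
        offset                                        ∎
      tight (inj₂ above) i wi≢0 = begin
        dot normal (x i)                              ≈⟨ solve 2 (λ f m → f := m :+ (:- m :- (:- f))) refl (dot normal (x i)) offset ⟩
        offset + (- offset - - dot normal (x i))      ≈⟨ +-congˡ (integral wi≢0 (slack w≥0 w≈1 (λ i → neg-mono-≤ (above (point∈conv x i))) negated i)) ⟩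
        offset + 0#                                   ≈⟨ +-identityʳ _ ⟩
        offset                                        ∎
        where
        negated : sum (λ i → w i * - dot normal (x i)) ≈ - offset
        negated = trans (sum-cong-≋ (λ i → *-comm (w i) (- dot normal (x i))))
          (trans (dot-neg (λ i → dot normal (x i)) w) (-‿cong (trans (dot-comm (λ i → dot normal (x i)) w) average)))
      vertex : ∃[ i ] w i ≢0 → v ∈ ⟦ x ⟧
      vertex (i , wi≢0) = i , λ a → sym (proj₁ face {x i} (point∈conv x i , tight side i wi≢0) a)

  -- The levels 1 and 0 suit the cross-polytope, where each vertex is its own separating vector.
  Separates : ∀ {n d} → Vector (Point d) n → Fin n → Point d → Set
  Separates x i c = dot c (x i) ≈ 1# × (∀ {l} → l ≢ i → dot c (x l) ≤ 0#)

  -- On the hyperplane at level 1, `slack` removes all weight from the points other than `x i`.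
  separated⇒vertex : ∀ {n d} (x : Vector (Point d) n) {i c} → Separates x i c → ∀ {v} → v ≋ x i → v ∈ vert (conv x)
  separated⇒vertex {n} {d} x {i} {c} (at , off) {v} v≋ =
    H , ((x i , point∈conv x i , at) , inj₁ (conv-≤ c below)) ,
    (λ (p∈ , on-H) a → trans (only p∈ on-H a) (sym (v≋ a))) ,
    λ {p} p≋ → (unit i , unit-nonNeg i , sum-unit i , λ a → trans (p≋ a) (trans (v≋ a) (sym (combination-unit x i a)))) ,
               trans (dot-cong {u = c} {c} (λ _ → refl) (λ a → trans (p≋ a) (v≋ a))) at
    where
    H : Hyperplane d
    H = record { normal = c ; offset = 1# ; nonzero = λ c≈0 → 0≉1 (trans (sym (dot-zeroˡ c≈0)) at) }
    below : ∀ l → dot c (x l) ≤ 1#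
    below l with l ≟ i
    ... | yes ≡.refl = ≤-reflexive at
    ... | no  l≢i    = ≤-trans (off l≢i) (<⇒≤ 0<1)
    only : ∀ {p} → p ∈ conv x → dot c p ≈ 1# → p ≋ x i
    only {p} (w , w≥0 , w≈1 , p≋) on-H a = trans (p≋ a)
      (trans (sum-cong-≋ (λ l → *-congʳ (w≈unit l))) (combination-unit x i a))
      where
      others : ∀ l → l ≢ i → w l ≈ 0#
      others l l≢i = integral positive (trans (*-comm _ _)
        (slack w≥0 w≈1 below (trans (sym (dot-conv c w x p≋)) on-H) l))
        where
        positive : (1# - dot c (x l)) ≢0
        positive eq = <⇒≉ (≤-<-trans (off l≢i) 0<1) (trans (solve 2 (λ f m → f := m :- (m :- f)) refl (dot c (x l)) 1#)
          (trans (+-congˡ (trans (-‿cong eq) -0#≈0#)) (+-identityʳ _)))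
      scaled : ∀ l → w l ≈ w i * unit i l
      scaled l with l ≟ i
      ... | yes ≡.refl = sym (trans (*-congˡ (unit-diagonal i)) (*-identityʳ _))
      ... | no  l≢i    = trans (others l l≢i) (sym (trans (*-congˡ (unit-off-diagonal (λ eq → l≢i (≡.sym eq)))) (zeroʳ _)))
      wi≈1 : w i ≈ 1#
      wi≈1 = trans (sym (trans (sum-cong-≋ scaled) (dot-unitʳ (λ _ → w i) i))) w≈1
      w≈unit : ∀ l → w l ≈ unit i l
      w≈unit l = trans (scaled l) (trans (*-congʳ wi≈1) (*-identityˡ _))

  separated⇒distinct : ∀ {n d} (x : Vector (Point d) n) → (∀ i → ∃[ c ] Separates x i c) → ∀ {i j} → x i ≋ x j → i ≡ j
  separated⇒distinct x separation {i} {j} xi≋xj = decidable-stable (i ≟ j) λ i≢j →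
    let c , at , off = separation i
    in 0<1 (≤-respˡ (trans (sym (dot-cong {u = c} {c} (λ _ → refl) xi≋xj)) at) (off (λ j≡i → i≢j (≡.sym j≡i))))

-- A member of the family: a truncated cross-polytope

module CrossPolytope (em : ExcludedMiddle 0ℓ) (ℝ : Reals) (d k : ℕ) (k≤d : suc k ℕ.≤ suc d) where
  open Reals ℝ hiding (zero)
  open OrderedField em ℝ
  open Geometry ℝ
  open LinearAlgebra em ℝ
  open ConvexPosition em ℝ
  open IntegerSolver commutativeRing
  open import Algebra.Definitions.RawMonoid +-rawMonoid using (sum)
  open import Algebra.Properties.CommutativeMonoid.Sum +-commutativeMonoid using (sum-cong-≋; ∑-distrib-+)
  open import Algebra.Properties.Ring ring using (-0#≈0#)
  open import Relation.Binary.Reasoning.Setoid setoid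

  opposite : Fin (suc k) → Fin (suc d)
  opposite b = inject≤ b k≤d

  vertex : Fin (suc d) ⊎ Fin (suc k) → Point (suc d)
  vertex (inj₁ a)   = unit a
  vertex (inj₂ b) c = - unit (opposite b) c

  -- All unit vectors and the negatives of the first few. The sizes are successors, so the first
  -- unit vector and its negative both occur, as `affinelySpanning` requires.
  cross : Vector (Point (suc d)) (suc d ℕ.+ suc k)
  cross i = vertex (splitAt (suc d) i)

  dot-negʳ : ∀ (u p : Point (suc d)) → dot u (λ a → - p a) ≈ - dot u p
  dot-negʳ u p = trans (dot-comm u (λ a → - p a)) (trans (dot-neg p u) (-‿cong (dot-comm p u)))

  -unit≤0 : ∀ (a b : Fin (suc d)) → - unit a b ≤ 0#
  -unit≤0 a b = ≤-respʳ -0#≈0# (neg-mono-≤ (unit-nonNeg a b))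

  vertex-self : ∀ s → dot (vertex s) (vertex s) ≈ 1#
  vertex-self (inj₁ a) = trans (dot-unitʳ (unit a) a) (unit-diagonal a)
  vertex-self (inj₂ b) = begin
    dot (λ c → - unit (opposite b) c) (λ c → - unit (opposite b) c)   ≈⟨ dot-negʳ (λ c → - unit (opposite b) c) (unit (opposite b)) ⟩
    - dot (λ c → - unit (opposite b) c) (unit (opposite b))           ≈⟨ -‿cong (dot-unitʳ (λ c → - unit (opposite b) c) (opposite b)) ⟩
    - - unit (opposite b) (opposite b)                                ≈⟨ solve 1 (λ x → :- :- x := x) refl _ ⟩
    unit (opposite b) (opposite b)                                    ≈⟨ unit-diagonal (opposite b) ⟩
    1#                                                                ∎

  vertex-other : ∀ s t → t ≢ s → dot (vertex s) (vertex t) ≤ 0#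
  vertex-other (inj₁ a) (inj₁ b) t≢s = ≤-reflexive (trans (dot-unitʳ (unit a) b) (unit-off-diagonal {a = a} {b} λ { ≡.refl → t≢s ≡.refl }))
  vertex-other (inj₁ a) (inj₂ b) t≢s = ≤-respˡ (sym (trans (dot-negʳ (unit a) (unit (opposite b))) (-‿cong (dot-unitʳ (unit a) (opposite b))))) (-unit≤0 a (opposite b))
  vertex-other (inj₂ a) (inj₁ b) t≢s = ≤-respˡ (sym (dot-unitʳ (λ c → - unit (opposite a) c) b)) (-unit≤0 (opposite a) b)
  vertex-other (inj₂ a) (inj₂ b) t≢s = ≤-reflexive (begin
    dot (λ c → - unit (opposite a) c) (λ c → - unit (opposite b) c)   ≈⟨ dot-negʳ (λ c → - unit (opposite a) c) (unit (opposite b)) ⟩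
    - dot (λ c → - unit (opposite a) c) (unit (opposite b))           ≈⟨ -‿cong (dot-unitʳ (λ c → - unit (opposite a) c) (opposite b)) ⟩
    - - unit (opposite a) (opposite b)                                ≈⟨ solve 1 (λ x → :- :- x := x) refl _ ⟩
    unit (opposite a) (opposite b)                                    ≈⟨ unit-off-diagonal (λ eq → t≢s (≡.cong inj₂ (≡.sym (FinP.inject≤-injective k≤d k≤d a b eq)))) ⟩
    0#                                                                ∎)

  separation : ∀ i → ∃[ c ] Separates cross i c
  separation i = cross i , vertex-self (splitAt (suc d) i) , λ {l} l≢i →
    vertex-other (splitAt (suc d) i) (splitAt (suc d) l) λ eq → l≢i
      (≡.trans (≡.sym (FinP.join-splitAt (suc d) (suc k) l))
        (≡.trans (≡.cong (join (suc d) (suc k)) eq) (FinP.join-splitAt (suc d) (suc k) i)))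

  sum-splitAt : ∀ m {n} (f : Fin m ⊎ Fin n → Carrier) →
    sum (λ i → f (splitAt m i)) ≈ sum (λ a → f (inj₁ a)) + sum (λ b → f (inj₂ b))
  sum-splitAt zero    f = sym (+-identityˡ _)
  sum-splitAt (suc m) f = trans (+-congˡ (trans (sum-cong-≋ (λ i → shift (splitAt m i))) (sum-splitAt m g))) (sym (+-assoc _ _ _))
    where
    g : _ → Carrier
    g = λ { (inj₁ a) → f (inj₁ (suc a)) ; (inj₂ b) → f (inj₂ b) }
    shift : ∀ s → f (map₁ suc s) ≈ g s
    shift (inj₁ a) = refl
    shift (inj₂ b) = refl

  unit-sym : ∀ {n} (a b : Fin n) → unit a b ≈ unit b a
  unit-sym zero    zero    = refl
  unit-sym zero    (suc b) = refl
  unit-sym (suc a) zero    = refl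
  unit-sym (suc a) (suc b) = unit-sym a b

  two : Carrier
  two = 1# + 1#

  two≢0 : two ≢0
  two≢0 eq = <⇒≉ (<-≤-trans 0<1 (≤-respˡ (+-identityʳ 1#) (+-monoʳ-≤ 1# (<⇒≤ 0<1)))) (sym eq)

  affinelySpanning : ∀ p → p ∈ aff cross
  affinelySpanning p = affine-weights (inverse two two≢0)
    where
    affine-weights : ∃[ h ] two * h ≈ 1# → p ∈ aff cross
    affine-weights (h , 2h≈1) = (λ i → weight (splitAt (suc d) i)) , weights-sum , λ c → sym (coordinate c)
      where
      -- Equal weights on the first unit vector and its negative cancel; half of the defect
      -- `1# - sum p` on each brings the total weight to 1.
      t : Carrier
      t = (1# - sum p) * h
      weight : Fin (suc d) ⊎ Fin (suc k) → Carrier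
      weight (inj₁ a) = p a + t * unit zero a
      weight (inj₂ b) = t * unit zero b
      spike : ∀ {n} → sum (λ (a : Fin (suc n)) → t * unit zero a) ≈ t
      spike {n} = dot-unitʳ {suc n} (λ _ → t) zero
      weights-sum : sum (λ i → weight (splitAt (suc d) i)) ≈ 1#
      weights-sum = begin
        sum (λ i → weight (splitAt (suc d) i))                                 ≈⟨ sum-splitAt (suc d) weight ⟩
        sum (λ a → p a + t * unit zero a) + sum (λ (b : Fin (suc k)) → t * unit zero b) ≈⟨ +-cong (trans (∑-distrib-+ p (λ a → t * unit zero a)) (+-congˡ (spike {d}))) (spike {k}) ⟩
        sum p + t + t                                                          ≈⟨ regroup (sum p) 1# h ⟩
        sum p + (1# - sum p) * ((1# + 1#) * h)                                 ≈⟨ +-congˡ (trans (*-congˡ 2h≈1) (*-identityʳ _)) ⟩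
        sum p + (1# - sum p)                                                   ≈⟨ solve 2 (λ s e → s :+ (e :- s) := e) refl (sum p) 1# ⟩
        1#                                                                     ∎
        where
        regroup : ∀ s e h → s + (e - s) * h + (e - s) * h ≈ s + (e - s) * ((1# + 1#) * h)
        regroup s e h = trans (trans (+-assoc _ _ _) (+-congˡ (sym (distribˡ (e - s) h h))))
          (+-congˡ (*-congˡ (sym (trans (distribʳ h 1# 1#) (+-cong (*-identityˡ h) (*-identityˡ h))))))
      coordinate : ∀ c → combination (λ i → weight (splitAt (suc d) i)) cross c ≈ p c
      coordinate c = begin
        sum (λ i → weight (splitAt (suc d) i) * vertex (splitAt (suc d) i) c)
          ≈⟨ sum-splitAt (suc d) (λ s → weight s * vertex s c) ⟩
        sum (λ a → (p a + t * unit zero a) * unit a c) + sum (λ b → t * unit zero b * - unit (opposite b) c)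
          ≈⟨ +-cong (trans (sum-cong-≋ {suc d} (λ a → *-congˡ {p a + t * unit zero a} (unit-sym a c))) (dot-unitʳ (λ a → p a + t * unit zero a) c))
                    (trans (sum-cong-≋ {suc k} (λ b → shuffle t (unit zero b) (- unit (opposite b) c))) (dot-unitʳ (λ b → t * - unit (opposite b) c) zero)) ⟩
        (p c + t * unit zero c) + t * - unit zero c
          ≈⟨ solve 3 (λ p t u → (p :+ t :* u) :+ t :* :- u := p) refl (p c) t (unit zero c) ⟩
        p c ∎
        where
        shuffle : ∀ t u v → t * u * v ≈ t * v * u
        shuffle = solve 3 (λ t u v → t :* u :* v := t :* v :* u) refl

  cross∈𝒞 : 𝒞ˢ (suc d) (suc d ℕ.+ suc k) cross
  cross∈𝒞 = record
    { distinct = λ {i} {j} → separated⇒distinct cross separation {i} {j}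
    ; affinelySpanning = affinelySpanning
    ; strictlyConvexPosition = (λ {v} (i , v≋) → separated⇒vertex cross {c = cross i} (proj₂ (separation i)) {v} v≋) , λ {v} → vert⊆ cross {v}
    }

-- The rational bound and its order of growth

module Rationals where

  /-mono-≤ : ∀ p q m n → p ℤ.* + suc n ℤ.≤ q ℤ.* + suc m → p ℚ./ suc m ℚ.≤ q ℚ./ suc n
  /-mono-≤ p q m n le = ℚP.toℚᵘ-cancel-≤
    (ℚᵘP.≤-respˡ-≃ (ℚᵘP.≃-sym (ℚP.toℚᵘ-fromℚᵘ (mkℚᵘ p m)))
      (ℚᵘP.≤-respʳ-≃ (ℚᵘP.≃-sym (ℚP.toℚᵘ-fromℚᵘ (mkℚᵘ q n))) (*≤* le)))

  /-*-/ : ∀ p q m n → (p ℚ./ suc m) ℚ.* (q ℚ./ suc n) ≡ (p ℤ.* q) ℚ./ (suc m ℕ.* suc n)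
  /-*-/ p q m n = ℚP.toℚᵘ-injective (ℚᵘP.≃-trans (ℚP.toℚᵘ-homo-* (p ℚ./ suc m) (q ℚ./ suc n))
    (ℚᵘP.≃-trans (ℚᵘP.*-cong (ℚP.toℚᵘ-fromℚᵘ (mkℚᵘ p m)) (ℚP.toℚᵘ-fromℚᵘ (mkℚᵘ q n)))
      (ℚᵘP.≃-sym (ℚP.toℚᵘ-fromℚᵘ (mkℚᵘ p m ℚᵘ.* mkℚᵘ q n)))))

  boundℤ orderℤ : ℕ → ℕ → ℤ
  boundℤ d k = + d ℤ.* + d ℤ.- + k ℤ.* + k ℤ.+ + d ℤ.+ + k
  orderℤ d k = (+ d ℤ.- + k) ℤ.* + d

  -- The factorisation (d + k)(d - k + 1) with j = d - k, which shows the numerator to be a natural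
  -- number.
  bound-numerator : ∀ k j → boundℤ (k ℕ.+ j) k ≡ + ((k ℕ.+ j ℕ.+ k) ℕ.* suc j)
  bound-numerator k j = ≡.trans (identity (+ k) (+ j)) (≡.sym (ℤP.pos-* (k ℕ.+ j ℕ.+ k) (suc j)))
    where
    identity : ∀ k j → (k ℤ.+ j) ℤ.* (k ℤ.+ j) ℤ.- k ℤ.* k ℤ.+ (k ℤ.+ j) ℤ.+ k ≡ (k ℤ.+ j ℤ.+ k) ℤ.* (1ℤ ℤ.+ j)
    identity = ℤSolver.solve-∀

  order-numerator : ∀ k j → orderℤ (k ℕ.+ j) k ≡ + (j ℕ.* (k ℕ.+ j))
  order-numerator k j = ≡.trans (identity (+ k) (+ j)) (≡.sym (ℤP.pos-* j (k ℕ.+ j)))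
    where
    identity : ∀ k j → (k ℤ.+ j ℤ.- k) ℤ.* (k ℤ.+ j) ≡ j ℤ.* (k ℤ.+ j)
    identity = ℤSolver.solve-∀

  -- For n = d + k, taking n² + n from 2n(d + 1) leaves n(d - k + 1). The factors 1 and 2 are
  -- cross-multiplied denominators.
  halved : ∀ k j m → let d = k ℕ.+ j ; n = d ℕ.+ k in
    n ℕ.* (2 ℕ.* suc d) ℕ.≤ (m ℕ.+ m) ℕ.+ (n ℕ.* n ℕ.+ n) → n ℕ.* suc j ℕ.* 1 ℕ.≤ m ℕ.* 2
  halved k j m counted = ℕP.+-cancelʳ-≤ (n ℕ.* n ℕ.+ n) (n ℕ.* suc j ℕ.* 1) (m ℕ.* 2) (begin
    n ℕ.* suc j ℕ.* 1 ℕ.+ (n ℕ.* n ℕ.+ n)         ≡⟨ left k j ⟩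
    n ℕ.* (2 ℕ.* suc (k ℕ.+ j))                   ≤⟨ counted ⟩
    m ℕ.+ m ℕ.+ (n ℕ.* n ℕ.+ n)                   ≡⟨ ≡.cong (ℕ._+ (n ℕ.* n ℕ.+ n)) (right m) ⟩
    m ℕ.* 2 ℕ.+ (n ℕ.* n ℕ.+ n)                   ∎)
    where
    open ℕP.≤-Reasoning
    n = k ℕ.+ j ℕ.+ k
    left : ∀ k j → (k ℕ.+ j ℕ.+ k) ℕ.* suc j ℕ.* 1 ℕ.+ ((k ℕ.+ j ℕ.+ k) ℕ.* (k ℕ.+ j ℕ.+ k) ℕ.+ (k ℕ.+ j ℕ.+ k))
      ≡ (k ℕ.+ j ℕ.+ k) ℕ.* (2 ℕ.* suc (k ℕ.+ j))
    left = ℕSolver.solve-∀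
    right : ∀ m → m ℕ.+ m ≡ m ℕ.* 2
    right = ℕSolver.solve-∀

  bound≤ : ∀ {d k m} → k ℕ.< d → (d ℕ.+ k) ℕ.* (2 ℕ.* suc d) ℕ.≤ (m ℕ.+ m) ℕ.+ ((d ℕ.+ k) ℕ.* (d ℕ.+ k) ℕ.+ (d ℕ.+ k)) →
    bound d k ℚ.≤ + m ℚ./ 1
  bound≤ {d} {k} {m} k<d counted with j , ≡.refl ← ℕP.m≤n⇒∃[o]m+o≡n (ℕP.<⇒≤ k<d) =
    /-mono-≤ (boundℤ d k) (+ m) 1 0 (begin
      boundℤ d k ℤ.* + 1                     ≡⟨ ≡.cong (ℤ._* + 1) (bound-numerator k j) ⟩
      + ((d ℕ.+ k) ℕ.* suc j) ℤ.* + 1        ≡⟨ ℤP.pos-* ((d ℕ.+ k) ℕ.* suc j) 1 ⟨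
      + ((d ℕ.+ k) ℕ.* suc j ℕ.* 1)          ≤⟨ +≤+ (halved k j m counted) ⟩
      + (m ℕ.* 2)                            ≡⟨ ℤP.pos-* m 2 ⟩
      + m ℤ.* + 2                            ∎)
    where open ℤP.≤-Reasoning

  -- The bound is (d + k)(d - k + 1) / 2, where d ≤ d + k ≤ 2d and, as k < d, d - k ≤ d - k + 1 ≤
  -- 2(d - k). Hence the constants 1/2 and 2.
  half two : ℚ
  half = + 1 ℚ./ 2
  two  = + 2 ℚ./ 1

  lower : ∀ d k → Range d k → half ℚ.* order d k ℚ.≤ bound d k
  lower d k (_ , _ , k<d) with j , ≡.refl ← ℕP.m≤n⇒∃[o]m+o≡n (ℕP.<⇒≤ k<d) =
    ≡.subst (ℚ._≤ bound d k) (≡.sym (/-*-/ (+ 1) (orderℤ d k) 1 0))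
      (/-mono-≤ (+ 1 ℤ.* orderℤ d k) (boundℤ d k) 1 1 (ℤP.*-monoʳ-≤-nonNeg (+ 2) (begin
        + 1 ℤ.* orderℤ d k                   ≡⟨ ℤP.*-identityˡ (orderℤ d k) ⟩
        orderℤ d k                           ≡⟨ order-numerator k j ⟩
        + (j ℕ.* (k ℕ.+ j))                  ≤⟨ +≤+ (ℕP.*-mono-≤ (ℕP.n≤1+n j) (ℕP.m≤m+n (k ℕ.+ j) k)) ⟩
        + (suc j ℕ.* (k ℕ.+ j ℕ.+ k))        ≡⟨ ≡.cong +_ (ℕP.*-comm (suc j) (k ℕ.+ j ℕ.+ k)) ⟩
        + ((k ℕ.+ j ℕ.+ k) ℕ.* suc j)        ≡⟨ bound-numerator k j ⟨
        boundℤ d k                           ∎)))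
    where open ℤP.≤-Reasoning

  upper : ∀ d k → Range d k → bound d k ℚ.≤ two ℚ.* order d k
  upper d k (_ , _ , k<d) with j , ≡.refl ← ℕP.m≤n⇒∃[o]m+o≡n k<d =
    ≡.subst₂ ℚ._≤_ (≡.cong (λ d → bound d k) (ℕP.+-suc k j)) (≡.cong (λ d → two ℚ.* order d k) (ℕP.+-suc k j)) main
    where
    d′ n : ℕ
    d′ = k ℕ.+ suc j
    n  = d′ ℕ.+ k
    -- The expansion of 4(d - k)d - (d + k)(d - k + 1) at d = k + j + 1.
    slack : ℕ
    slack = 2 ℕ.* (j ℕ.* k) ℕ.+ 3 ℕ.* (j ℕ.* j) ℕ.+ 5 ℕ.* j ℕ.+ 2
    identity : ∀ k j → (k ℕ.+ suc j ℕ.+ k) ℕ.* suc (suc j) ℕ.* 1 ℕ.+ (2 ℕ.* (j ℕ.* k) ℕ.+ 3 ℕ.* (j ℕ.* j) ℕ.+ 5 ℕ.* j ℕ.+ 2)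
      ≡ 2 ℕ.* (suc j ℕ.* (k ℕ.+ suc j)) ℕ.* 2
    identity = ℕSolver.solve-∀
    open ℤP.≤-Reasoning
    main : bound d′ k ℚ.≤ two ℚ.* order d′ k
    main = ≡.subst (bound d′ k ℚ.≤_) (≡.sym (/-*-/ (+ 2) (orderℤ d′ k) 0 0))
      (/-mono-≤ (boundℤ d′ k) (+ 2 ℤ.* orderℤ d′ k) 1 0 (begin
        boundℤ d′ k ℤ.* + 1                        ≡⟨ ≡.cong (ℤ._* + 1) (bound-numerator k (suc j)) ⟩
        + (n ℕ.* suc (suc j)) ℤ.* + 1              ≡⟨ ℤP.pos-* (n ℕ.* suc (suc j)) 1 ⟨
        + (n ℕ.* suc (suc j) ℕ.* 1)                ≤⟨ +≤+ (ℕP.m≤m+n _ slack) ⟩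
        + (n ℕ.* suc (suc j) ℕ.* 1 ℕ.+ slack)      ≡⟨ ≡.cong +_ (identity k j) ⟩
        + (2 ℕ.* (suc j ℕ.* d′) ℕ.* 2)             ≡⟨ ℤP.pos-* (2 ℕ.* (suc j ℕ.* d′)) 2 ⟩
        + (2 ℕ.* (suc j ℕ.* d′)) ℤ.* + 2           ≡⟨ ≡.cong (ℤ._* + 2) (ℤP.pos-* 2 (suc j ℕ.* d′)) ⟩
        + 2 ℤ.* + (suc j ℕ.* d′) ℤ.* + 2           ≡⟨ ≡.cong (λ i → + 2 ℤ.* i ℤ.* + 2) (order-numerator k (suc j)) ⟨
        + 2 ℤ.* orderℤ d′ k ℤ.* + 2                ∎))

  bound-Θ-order : Θ-on Range bound order
  bound-Θ-order = half , two , ℚP.positive⁻¹ half , ℚP.positive⁻¹ two , λ d k range → lower d k range , upper d k range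

-- Existence of the minimum

module Minimum (em : ExcludedMiddle 0ℓ) where

  least : ∀ {S : Pred ℕ 0ℓ} {n} → n ∈ S → ∃ (IsMinimum S)
  least {S} {n} = go (<-wellFounded n)
    where
    go : ∀ {n} → Acc ℕ._<_ n → n ∈ S → ∃ (IsMinimum S)
    go {n} (acc rec) n∈ with em {∃[ s ] s ∈ S × s ℕ.< n}
    ... | yes (s , s∈ , s<n) = go (rec s<n) s∈
    ... | no  none           = n , n∈ , λ s∈ → ℕP.≮⇒≥ λ s<n → none (_ , s∈ , s<n)

  minimal-sa : ∀ (ℝ : Reals) d k → Range d k → ∃ (Geometry.Counting.IsMinSa ℝ em d (d ℕ.+ k))
  minimal-sa ℝ (suc d) (suc k) (_ , _ , k<d) = least (cross , cross∈𝒞 , ≡.refl)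
    where open CrossPolytope em ℝ d k (ℕP.<⇒≤ k<d)

open import Data.Nat using (_+_)
open import Data.Rational using (_≤_; _/_)

theorem2p18 : (em : ExcludedMiddle 0ℓ) (ℝ : Reals) →
    (∀ (d k : ℕ) → Range d k →
    ∃[ m ] Geometry.Counting.IsMinSa ℝ em d (d + k) m × bound d k ≤ + m / 1)
    × Θ-on Range bound order
theorem2p18 em ℝ = main , Rationals.bound-Θ-order
  where
  bounded : ∀ d k → Range d k → ∀ m → Geometry.Counting.IsMinSa ℝ em d (d + k) m → bound d k ≤ + m / 1
  bounded d k (_ , _ , k<d) m ((x , x∈𝒞 , m≡sa) , _) =
    ≡.subst (λ m → bound d k ≤ + m / 1) (≡.sym m≡sa) (Rationals.bound≤ {d} {k} {Geometry.Counting.sa ℝ em x} k<d (LowerBound.lower-bound em ℝ x x∈𝒞))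
  main : ∀ d k → Range d k → ∃[ m ] Geometry.Counting.IsMinSa ℝ em d (d + k) m × bound d k ≤ + m / 1
  main d k range =
    let m , minimum = Minimum.minimal-sa em ℝ d k range in m , minimum , bounded d k range m minimum
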